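{- The finite projective Desarguesian plane $PG(2,9)$ of order $9$ is a Poncelet plane.
   Context: $PG(2,9)$ is the projective plane over the field $GF(9)$: points are nonzero column vectors $[x,y,z]^T$ over $GF(9)$ up to nonzero scalar multiples, lines are nonzero row vectors $[a,b,c]$ up to nonzero scalars, and $[x,y,z]^T$ lies on $[a,b,c]$ iff $ax+by+cz=0$. An oval in a plane of order $n$ is a set of $n+1$ points no three collinear. A secant of an oval $O$ is a line meeting $O$ in two points; a tangent is a line meeting $O$ in exactly one point. For an ordered pair of ovals $(O_t,O_s)$, an $m$-sided Poncelet polygon ($3\le m\le n+1$) is a cyclically ordered $m$-tuple of distinct points of $O_s$ such that each line joining cyclically consecutive vertices is a tangent of $O_t$. $(O_t,O_s)$ is a Poncelet $m$-pair ($3\le m\le n+1$) if an $m$-sided Poncelet polygon exists but no $m'$-sided one for $m'\ne m$, $3\le m'\le n+1$; a Poncelet $0$-pair if no secant of $O_s$ is a tangent of $O_t$; a Poncelet $\infty$-pair if some secant of $O_s$ is a tangent of $O_t$ but no $m$-sided Poncelet polygon ($3\le m\le n+1$) exists. A finite projective plane is a Poncelet plane if every pair of ovals in it is a Poncelet $m$-pair for some $3\le m\le n+1$, a Poncelet $0$-pair, or a Poncelet $\infty$-pair. -}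

module Defs where

open import Data.Nat using (ℕ; zero; suc; _≤_)
open import Data.Fin using (Fin; toℕ)
open import Data.Product using (Σ; ∃; _×_; _,_)
open import Data.Product.Properties using (≡-dec)
open import Data.Sum using (_⊎_)
open import Data.List using (List; length; filter; allFin)
open import Relation.Binary.PropositionalEquality using (_≡_; _≢_; refl)
open import Relation.Nullary using (¬_; Dec; yes; no)

data F3 : Set where
  o₀ o₁ o₂ : F3

_+₃_ : F3 → F3 → F3
o₀ +₃ y = y
o₁ +₃ o₀ = o₁
o₁ +₃ o₁ = o₂
o₁ +₃ o₂ = o₀
o₂ +₃ o₀ = o₂
o₂ +₃ o₁ = o₀
o₂ +₃ o₂ = o₁

-₃_ : F3 → F3
-₃ o₀ = o₀
-₃ o₁ = o₂
-₃ o₂ = o₁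

_*₃_ : F3 → F3 → F3
o₀ *₃ y = o₀
o₁ *₃ y = y
o₂ *₃ y = -₃ y

_≟₃_ : (x y : F3) → Dec (x ≡ y)
o₀ ≟₃ o₀ = yes refl
o₀ ≟₃ o₁ = no (λ ())
o₀ ≟₃ o₂ = no (λ ())
o₁ ≟₃ o₀ = no (λ ())
o₁ ≟₃ o₁ = yes refl
o₁ ≟₃ o₂ = no (λ ())
o₂ ≟₃ o₀ = no (λ ())
o₂ ≟₃ o₁ = no (λ ())
o₂ ≟₃ o₂ = yes refl

-- GF(9) = GF(3)[i]/(i² + 1); the pair (a , b) stands for a + b i.
-- (x² + 1 is irreducible over GF(3), so this is the field with 9 elements.)

GF9 : Set
GF9 = F3 × F3

0F : GF9
0F = o₀ , o₀

_+F_ : GF9 → GF9 → GF9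
(a , b) +F (c , d) = (a +₃ c) , (b +₃ d)

_*F_ : GF9 → GF9 → GF9
(a , b) *F (c , d) = ((a *₃ c) +₃ (-₃ (b *₃ d))) , ((a *₃ d) +₃ (b *₃ c))

_≟F_ : (x y : GF9) → Dec (x ≡ y)
_≟F_ = ≡-dec _≟₃_ _≟₃_

-- Vectors of GF(9)^3.  Points of PG(2,9) are nonzero column vectors up to
-- nonzero scalars; lines are nonzero row vectors up to nonzero scalars.

Vec3 : Set
Vec3 = GF9 × GF9 × GF9

zero3 : Vec3
zero3 = 0F , 0F , 0F

NonZeroV : Vec3 → Set
NonZeroV v = v ≢ zero3

scale : GF9 → Vec3 → Vec3
scale c (x , y , z) = (c *F x) , (c *F y) , (c *F z)

SamePoint : Vec3 → Vec3 → Set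
SamePoint v w = Σ GF9 (λ c → (c ≢ 0F) × (v ≡ scale c w))

dot : Vec3 → Vec3 → GF9
dot (a , b , c) (x , y , z) = ((a *F x) +F (b *F y)) +F (c *F z)

OnLine : Vec3 → Vec3 → Set
OnLine ℓ P = dot ℓ P ≡ 0F

-- Ovals of PG(2,9): sets of n + 1 = 10 points, no three collinear,
-- given as a family of 10 pairwise distinct points.

record Oval : Set where
  field
    pt       : Fin 10 → Vec3
    nonzero  : ∀ i → NonZeroV (pt i)
    distinct : ∀ i j → i ≢ j → ¬ SamePoint (pt i) (pt j)
    noThreeCollinear : ∀ i j k → i ≢ j → j ≢ k → i ≢ k →
      ∀ ℓ → NonZeroV ℓ → ¬ (OnLine ℓ (pt i) × OnLine ℓ (pt j) × OnLine ℓ (pt k))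
open Oval public

OnOval : Oval → Vec3 → Set
OnOval O P = Σ (Fin 10) (λ i → SamePoint P (pt O i))

meetCount : Oval → Vec3 → ℕ
meetCount O ℓ = length (filter (λ i → dot ℓ (pt O i) ≟F 0F) (allFin 10))

Tangent : Oval → Vec3 → Set
Tangent O ℓ = NonZeroV ℓ × (meetCount O ℓ ≡ 1)

Secant : Oval → Vec3 → Set
Secant O ℓ = NonZeroV ℓ × (meetCount O ℓ ≡ 2)

CycSucc : (m : ℕ) → Fin m → Fin m → Set
CycSucc m i j = (suc (toℕ i) ≡ toℕ j) ⊎ ((suc (toℕ i) ≡ m) × (toℕ j ≡ 0))

PonceletPolygon : Oval → Oval → ℕ → Set
PonceletPolygon Ot Os m =
  Σ (Fin m → Vec3) λ P →
    (∀ i → OnOval Os (P i)) ×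
    (∀ i j → i ≢ j → ¬ SamePoint (P i) (P j)) ×
    (∀ i j → CycSucc m i j →
       Σ Vec3 (λ ℓ → Tangent Ot ℓ × OnLine ℓ (P i) × OnLine ℓ (P j)))

PonceletMPair : Oval → Oval → ℕ → Set
PonceletMPair Ot Os m =
  (3 ≤ m) × (m ≤ 10) × PonceletPolygon Ot Os m ×
  (∀ m' → 3 ≤ m' → m' ≤ 10 → m' ≢ m → ¬ PonceletPolygon Ot Os m')

Poncelet0Pair : Oval → Oval → Set
Poncelet0Pair Ot Os = ∀ ℓ → Secant Os ℓ → ¬ Tangent Ot ℓ

PonceletInfPair : Oval → Oval → Set
PonceletInfPair Ot Os =
  (Σ Vec3 λ ℓ → Secant Os ℓ × Tangent Ot ℓ) ×
  (∀ m → 3 ≤ m → m ≤ 10 → ¬ PonceletPolygon Ot Os m)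

PonceletPlane-PG29 : Set
PonceletPlane-PG29 = ∀ (Ot Os : Oval) →
  (Σ ℕ (λ m → PonceletMPair Ot Os m)) ⊎ Poncelet0Pair Ot Os ⊎ PonceletInfPair Ot Os

{-# OPTIONS --safe #-}
-- Call two points of Os adjacent when they lie on a common tangent of Ot; a Poncelet polygon is
-- a cycle of this graph, so all cycles have to be shown to have the same length.
--
-- By Segre's theorem an oval of PG(2,9) is a conic and its tangents are the polars of its points.
-- If the graph has a cycle with at least 4 edges, coordinates can be chosen in which Os is
-- yz + zx + xy = 0 and the tangents of Ot satisfy an equation with only three parameters
-- θ, β, γ ∈ GF(9)*, and the cycles of the 512 graphs so obtained are found by computation.
module Submission where

open import Defs
import Algebra.Consequences.Propositional as Consequences
open import Algebra.Bundles using (CommutativeRing; RawRing)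
import Algebra.Properties.Ring as RingProperties
import Algebra.Solver.Ring as RingSolver
open import Algebra.Solver.Ring.AlmostCommutativeRing
  using (AlmostCommutativeRing; fromCommutativeRing; _-Raw-AlmostCommutative⟶_; Induced-equivalence)
open import Algebra.Structures using (IsCommutativeRing)
open import Data.Empty using (⊥-elim)
open import Data.Fin as Fin using (Fin)
import Data.Fin.Properties as Fin
open import Data.List using (List; []; _∷_; [_]; _++_; length; map; foldr; filter; allFin; concatMap)
import Data.List.Properties as List
import Data.List.Membership.DecPropositional as DecMembership
open import Data.List.Membership.Propositional using (_∈_; _∉_; lose)
open import Data.List.Membership.Propositional.Properties
  using (∈-∃++; ∈-filter⁺; ∈-filter⁻; ∈-allFin; ∈-map⁺; ∈-concatMap⁺)
open import Data.List.Relation.Binary.Permutation.Propositional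
  using (_↭_; ↭-refl; ↭-prep; ↭-trans; ↭-sym; ↭⇒↭ₛ)
open import Data.List.Relation.Binary.Permutation.Propositional.Properties
  using (shift; ↭-length; ∈-resp-↭)
import Data.List.Relation.Binary.Permutation.Setoid.Properties as Permutation
open import Data.List.Relation.Binary.Subset.Propositional using (_⊆_)
open import Data.List.Relation.Unary.All as All using (All; []; _∷_)
import Data.List.Relation.Unary.All.Properties as All
open import Data.List.Relation.Unary.AllPairs using ([]; _∷_)
open import Data.List.Relation.Unary.Any as Any using (here; there)
open import Data.List.Relation.Unary.Unique.DecPropositional using (unique?)
open import Data.List.Relation.Unary.Unique.Propositional using (Unique)
import Data.List.Relation.Unary.Unique.Propositional.Properties as Unique
open import Data.Maybe using (just; nothing)
open import Data.Nat as ℕ using (ℕ; zero; suc; _≤_; _<_; s≤s; z≤n)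
open import Data.Nat.DivMod using (_mod_; _%_; m<n⇒m%n≡m; n%n≡0)
import Data.Nat.Properties as ℕ
open import Data.Product using (Σ; ∃; _×_; _,_; proj₁; proj₂)
open import Data.Product.Properties using (≡-dec)
open import Data.Sum using (_⊎_; inj₁; inj₂)
open import Data.Unit using (⊤; tt)
open import Data.Vec as Vec using (Vec; []; _∷_; lookup; tabulate)
import Data.Vec.Properties as Vec
open import Function using (_∘_)
open import Level using (0ℓ)
open import Relation.Binary.Definitions using (DecidableEquality; WeaklyDecidable)
open import Relation.Binary.PropositionalEquality hiding ([_])
open import Relation.Nullary using (¬_; Dec; yes; no; ¬?)
open import Relation.Nullary.Decidable using (_×-dec_; _⊎-dec_; _→-dec_; map′; from-yes)

-- Let `i₀`, `i₁`, `i₂`, `i₃` be consecutive vertices of the long cycle. In coordinates with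
-- reference triangle `i₀`, `i₁`, `i₂` the three edges between them are the lines (0 , 0 , 1), (1 ,
-- 0 , 0) and (θ , 1 , 0). A dual conic through three non-concurrent lines has three coefficients up
-- to scale, so two ratios β and γ remain, and there are 8³ cases. Only one inclusion of graphs is
-- used: the endpoints of an edge become adjacent vertices of the normalised graph, and distinct
-- vertices stay distinct. Hence every cycle yields a cycle of the same length there, and surplus
-- adjacencies could only make the computed claim stronger. The geometry is done over an abstract
-- `Field9`, which keeps its identities symbolic; the arithmetic of GF(9) itself enters only through
-- finite checks.

-- For arbitrary operations, so that the same formulas apply to polynomials of the ring solver.
module VectorOps {A : Set} (_+_ _*_ : A → A → A) (-_ : A → A) where

  dotᵥ : A × A × A → A × A × A → A
  dotᵥ (a , b , c) (x , y , z) = ((a * x) + (b * y)) + (c * z)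

  crossᵥ : A × A × A → A × A × A → A × A × A
  crossᵥ (a , b , c) (x , y , z) =
    ((b * z) + (- (c * y))) , ((c * x) + (- (a * z))) , ((a * y) + (- (b * x)))

  detᵥ : A × A × A → A × A × A → A × A × A → A
  detᵥ u v w = dotᵥ (crossᵥ u v) w

  scaleᵥ : A → A × A × A → A × A × A
  scaleᵥ k (x , y , z) = (k * x) , (k * y) , (k * z)

  subᵥ : A × A × A → A × A × A → A × A × A
  subᵥ (a , b , c) (x , y , z) = (a + (- x)) , (b + (- y)) , (c + (- z))

  conicᵥ : A × A × A → A
  conicᵥ (x , y , z) = (y * z) + ((z * x) + (x * y))

  -- The dual conics through the lines (0 , 0 , 1), (1 , 0 , 0) and (θ , 1 , 0).
  envelopeᵥ : A → A → A → A × A × A → A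
  envelopeᵥ θ β γ (l , m , n) =
    ((l + (- (θ * m))) * m) + ((β * (m * n)) + (γ * (n * (l + (- (θ * m))))))

-- Besides the field laws only three facts about GF(9) enter the geometry: characteristic 3, the
-- number 8 of nonzero elements, and their product, which is -1 by Wilson's theorem.
record Field9 : Set₁ where
  infixl 6 _+_
  infixl 7 _*_
  infix  8 -_
  field
    F                 : Set
    _+_ _*_           : F → F → F
    -_                : F → F
    0# 1#             : F
    isCommutativeRing : IsCommutativeRing _≡_ _+_ _*_ -_ 0# 1#
    inv               : F → F
    inv-inverse       : ∀ x → x ≢ 0# → x * inv x ≡ 1#
    1≢0               : 1# ≢ 0#
    char3             : 1# + (1# + 1#) ≡ 0#
    _≟_               : DecidableEquality F
    nonzeros          : List F
    nonzeros-unique   : Unique nonzeros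
    nonzeros-nonzero  : ∀ {x} → x ∈ nonzeros → x ≢ 0#
    nonzeros-complete : ∀ x → x ≢ 0# → x ∈ nonzeros
    nonzeros-length   : length nonzeros ≡ 8
    nonzeros-product  : foldr _*_ 1# nonzeros ≡ - 1#

  commutativeRing : CommutativeRing 0ℓ 0ℓ
  commutativeRing = record { isCommutativeRing = isCommutativeRing }

module FieldSolver (K : Field9) where
  open Field9 K
  open IsCommutativeRing isCommutativeRing
    using (+-assoc; +-comm; +-identityˡ; +-identityʳ; *-identityˡ; zeroˡ; -‿inverseʳ)
  open RingProperties (CommutativeRing.ring commutativeRing)
    using (-‿involutive; -‿distribˡ-*; -0#≈0#; +-inverseˡ-unique)

  -- With coefficients in GF(3) the solver decides cancellation modulo 3.
  coefficients : RawRing 0ℓ 0ℓ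
  coefficients = record
    { Carrier = F3 ; _≈_ = _≡_ ; _+_ = _+₃_ ; _*_ = _*₃_ ; -_ = -₃_ ; 0# = o₀ ; 1# = o₁ }

  almostRing : AlmostCommutativeRing 0ℓ 0ℓ
  almostRing = fromCommutativeRing commutativeRing

  ⟦_⟧₃ : F3 → F
  ⟦ o₀ ⟧₃ = 0#
  ⟦ o₁ ⟧₃ = 1#
  ⟦ o₂ ⟧₃ = - 1#

  1+1≡-1 : 1# + 1# ≡ - 1#
  1+1≡-1 = +-inverseˡ-unique _ _ (trans (+-comm _ _) char3)

  -1-1≡1 : - 1# + - 1# ≡ 1#
  -1-1≡1 = trans (cong (_+ - 1#) (sym 1+1≡-1))
           (trans (+-assoc _ _ _) (trans (cong (1# +_) (-‿inverseʳ 1#)) (+-identityʳ 1#)))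

  ⟦⟧₃-+ : ∀ x y → ⟦ x +₃ y ⟧₃ ≡ ⟦ x ⟧₃ + ⟦ y ⟧₃
  ⟦⟧₃-+ o₀ y  = sym (+-identityˡ _)
  ⟦⟧₃-+ o₁ o₀ = sym (+-identityʳ _)
  ⟦⟧₃-+ o₁ o₁ = sym 1+1≡-1
  ⟦⟧₃-+ o₁ o₂ = sym (-‿inverseʳ 1#)
  ⟦⟧₃-+ o₂ o₀ = sym (+-identityʳ _)
  ⟦⟧₃-+ o₂ o₁ = sym (trans (+-comm _ _) (-‿inverseʳ 1#))
  ⟦⟧₃-+ o₂ o₂ = sym -1-1≡1

  ⟦⟧₃-neg : ∀ x → ⟦ -₃ x ⟧₃ ≡ - ⟦ x ⟧₃
  ⟦⟧₃-neg o₀ = sym -0#≈0#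
  ⟦⟧₃-neg o₁ = refl
  ⟦⟧₃-neg o₂ = sym (-‿involutive 1#)

  ⟦⟧₃-* : ∀ x y → ⟦ x *₃ y ⟧₃ ≡ ⟦ x ⟧₃ * ⟦ y ⟧₃
  ⟦⟧₃-* o₀ y = sym (zeroˡ _)
  ⟦⟧₃-* o₁ y = sym (*-identityˡ _)
  ⟦⟧₃-* o₂ y = trans (⟦⟧₃-neg y)
    (trans (cong -_ (sym (*-identityˡ _))) (-‿distribˡ-* 1# ⟦ y ⟧₃))

  morphism : coefficients -Raw-AlmostCommutative⟶ almostRing
  morphism = record
    { ⟦_⟧ = ⟦_⟧₃ ; +-homo = ⟦⟧₃-+ ; *-homo = ⟦⟧₃-* ; -‿homo = ⟦⟧₃-neg ; 0-homo = refl ; 1-homo = refl }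

  coefficients≟ : WeaklyDecidable (Induced-equivalence morphism)
  coefficients≟ x y with x ≟₃ y
  ... | yes refl = just refl
  ... | no  _    = nothing

  open RingSolver coefficients almostRing morphism coefficients≟ public
    using (Polynomial; solve; _:=_; con; _:+_; _:*_; :-_)

  module _ {n : ℕ} where
    open VectorOps {Polynomial n} _:+_ _:*_ :-_ public
      renaming ( dotᵥ to :dot; crossᵥ to :cross; detᵥ to :det; scaleᵥ to :scale; subᵥ to :sub
               ; conicᵥ to :conic; envelopeᵥ to :envelope )

-- Pigeonhole principle and the points outside a triangle

private variable A : Set

-- Pigeonhole: the head of `xs` is deleted from `ys`, and since it does not recur in `xs`, the tail
-- still embeds in what is left.
↭-of-⊆ : {xs ys : List A} → Unique xs → xs ⊆ ys → length ys ℕ.≤ length xs → xs ↭ ys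
↭-of-⊆ {xs = []} {[]} _ _ _ = ↭-refl
↭-of-⊆ {xs = x ∷ xs} (x∉ ∷ unique) xs⊆ys l with ∈-∃++ (xs⊆ys (here refl))
... | as , bs , refl = ↭-trans (↭-prep x (↭-of-⊆ unique xs⊆ l′)) (↭-sym (shift x as bs))
  where
  l′ : length (as ++ bs) ℕ.≤ length xs
  l′ = ℕ.≤-pred (subst (ℕ._≤ _) (↭-length (shift x as bs)) l)
  xs⊆ : xs ⊆ as ++ bs
  xs⊆ y∈ with ∈-resp-↭ (shift x as bs) (xs⊆ys (there y∈))
  ... | here refl = ⊥-elim (All.lookup x∉ y∈ refl)
  ... | there y∈′ = y∈′

-- A specification symmetric in the three points, so that one list `ls` serves the frames at all
-- three vertices of a triangle and products over it can be cancelled against each other.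
record Complement (i j k : Fin 10) (ls : List (Fin 10)) : Set where
  field
    unique   : Unique ls
    size     : length ls ≡ 7
    sound    : ∀ {l} → l ∈ ls → l ≢ i × l ≢ j × l ≢ k
    complete : ∀ {l} → l ≢ i → l ≢ j → l ≢ k → l ∈ ls

two-others : ∀ (i : Fin 10) → ∃ λ j → ∃ λ k → i ≢ j × j ≢ k × i ≢ k
two-others Fin.zero              = Fin.suc Fin.zero , Fin.suc (Fin.suc Fin.zero) , (λ ()) , (λ ()) , (λ ())
two-others (Fin.suc Fin.zero)    = Fin.zero , Fin.suc (Fin.suc Fin.zero) , (λ ()) , (λ ()) , (λ ())
two-others (Fin.suc (Fin.suc _)) = Fin.zero , Fin.suc Fin.zero , (λ ()) , (λ ()) , (λ ())

third : ∀ {i j : Fin 10} → i ≢ j → ∃ λ k → j ≢ k × i ≢ k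
third {i} {j} i≢j with two-others i
... | k , l , i≢k , k≢l , i≢l with k Fin.≟ j
... | yes refl = l , k≢l , i≢l
... | no  k≢j  = k , ≢-sym k≢j , i≢k

-- Type checking must not unfold the exhaustive check of others-length.
abstract
  others? : ∀ i j k (l : Fin 10) → Dec (l ≢ i × l ≢ j × l ≢ k)
  others? i j k l = ¬? (l Fin.≟ i) ×-dec ¬? (l Fin.≟ j) ×-dec ¬? (l Fin.≟ k)

  others-length : ∀ i j k → i ≢ j × j ≢ k × i ≢ k → length (filter (others? i j k) (allFin 10)) ≡ 7
  others-length = from-yes (Fin.all? λ i → Fin.all? λ j → Fin.all? λ k →
    (¬? (i Fin.≟ j) ×-dec ¬? (j Fin.≟ k) ×-dec ¬? (i Fin.≟ k))
      →-dec (length (filter (others? i j k) (allFin 10)) ℕ.≟ 7))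

  complement : ∀ {i j k} → i ≢ j → j ≢ k → i ≢ k → ∃ (Complement i j k)
  complement {i} {j} {k} i≢j j≢k i≢k = filter (others? i j k) (allFin 10) , record
    { unique   = Unique.filter⁺ (others? i j k) (Unique.allFin⁺ 10)
    ; size     = others-length i j k (i≢j , j≢k , i≢k)
    ; sound    = λ l∈ → proj₂ (∈-filter⁻ (others? i j k) {xs = allFin 10} l∈)
    ; complete = λ l≢i l≢j l≢k → ∈-filter⁺ (others? i j k) (∈-allFin _) (l≢i , l≢j , l≢k)
    }

rotate : ∀ {i j k ls} → Complement i j k ls → Complement j k i ls
rotate c = record
  { unique   = unique
  ; size     = size
  ; sound    = λ l∈ → let a , b , d = sound l∈ in b , d , a
  ; complete = λ a b d → complete d a b
  }
  where open Complement c

-- Quotients and products in a field with nine elements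

module FieldProperties (K : Field9) where
  open Field9 K
  open FieldSolver K
  open IsCommutativeRing isCommutativeRing using (*-identityˡ; *-identityʳ; zeroʳ)
  open CommutativeRing commutativeRing using (*-isCommutativeMonoid)
  open DecMembership _≟_ using (_∈?_)
  open RingProperties (CommutativeRing.ring commutativeRing) using (+-cancelʳ)
  open ≡-Reasoning

  -- The way hypotheses x ≡ y enter a ring identity for the solver.
  cancel : ∀ {a b x y} → x ≡ y → a + x ≡ b + y → a ≡ b
  cancel {a} {b} {x} refl eq = +-cancelʳ x a b eq

  difference-zero : ∀ {x y} → x + - y ≡ 0# → x ≡ y
  difference-zero {x} {y} eq = cancel (sym eq) (solve 2 (λ x y → x :+ con o₀ := y :+ (x :+ :- y)) refl x y)

  *-cancelˡ : ∀ {x y z} → x ≢ 0# → x * y ≡ x * z → y ≡ z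
  *-cancelˡ {x} {y} {z} x≢0 eq = begin
    y                ≡⟨ *-identityˡ y ⟨
    1# * y           ≡⟨ cong (_* y) (inv-inverse x x≢0) ⟨
    (x * inv x) * y  ≡⟨ solve 3 (λ x i y → (x :* i) :* y := i :* (x :* y)) refl x (inv x) y ⟩
    inv x * (x * y)  ≡⟨ cong (inv x *_) eq ⟩
    inv x * (x * z)  ≡⟨ solve 3 (λ x i y → (x :* i) :* y := i :* (x :* y)) refl x (inv x) z ⟨
    (x * inv x) * z  ≡⟨ cong (_* z) (inv-inverse x x≢0) ⟩
    1# * z           ≡⟨ *-identityˡ z ⟩
    z                ∎

  *-≢0 : ∀ {x y} → x ≢ 0# → y ≢ 0# → x * y ≢ 0#
  *-≢0 x≢0 y≢0 eq = y≢0 (*-cancelˡ x≢0 (trans eq (sym (zeroʳ _))))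

  neg-≢0 : ∀ {x} → x ≢ 0# → - x ≢ 0#
  neg-≢0 {x} x≢0 eq = x≢0 (cancel eq (solve 1 (λ x → x :+ :- x := con o₀ :+ con o₀) refl x))

  ∏ : List F → F
  ∏ = foldr _*_ 1#

  ∏-↭ : ∀ {xs ys} → xs ↭ ys → ∏ xs ≡ ∏ ys
  ∏-↭ xs↭ys = Permutation.foldr-commMonoid (setoid F)
    *-isCommutativeMonoid (↭⇒↭ₛ xs↭ys)

  ∏-nonzero : ∀ (f : A → F) {ls} → (∀ {l} → l ∈ ls → f l ≢ 0#) → ∏ (map f ls) ≢ 0#
  ∏-nonzero f {[]}     f≢0 = 1≢0
  ∏-nonzero f {l ∷ ls} f≢0 = *-≢0 (f≢0 (here refl)) (∏-nonzero f (f≢0 ∘ there))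

  ∏-quotient : ∀ (f g : A → F) {ls} → (∀ {l} → l ∈ ls → g l ≢ 0#) →
    ∏ (map (λ l → f l * inv (g l)) ls) * ∏ (map g ls) ≡ ∏ (map f ls)
  ∏-quotient f g {[]}     g≢0 = *-identityˡ 1#
  ∏-quotient f g {l ∷ ls} g≢0 = begin
    (f l * inv (g l) * q) * (g l * d)
        ≡⟨ solve 5 (λ a i q b d → (a :* i :* q) :* (b :* d) := a :* (b :* i) :* (q :* d)) refl _ _ _ _ _ ⟩
    f l * (g l * inv (g l)) * (q * d)
        ≡⟨ cong₂ (λ a b → f l * a * b) (inv-inverse _ (g≢0 (here refl))) (∏-quotient f g (g≢0 ∘ there)) ⟩
    f l * 1# * ∏ (map f ls)              ≡⟨ cong (_* ∏ (map f ls)) (*-identityʳ _) ⟩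
    f l * ∏ (map f ls)                   ∎
    where
    q = ∏ (map (λ l → f l * inv (g l)) ls)
    d = ∏ (map g ls)

  nonzeros-⊇ : ∀ {xs} → All (_≢ 0#) xs → xs ⊆ nonzeros
  nonzeros-⊇ xs≢0 x∈ = nonzeros-complete _ (All.lookup xs≢0 x∈)

  -- Wilson's theorem: the elements are all of F*.
  ∏-eight : ∀ {xs} → Unique xs → All (_≢ 0#) xs → length xs ≡ 8 → ∏ xs ≡ - 1#
  ∏-eight unique xs≢0 l = trans
    (∏-↭ (↭-of-⊆ unique (nonzeros-⊇ xs≢0) (ℕ.≤-reflexive (trans nonzeros-length (sym l)))))
    nonzeros-product

  missing-nonzero : ∀ xs → length xs ℕ.< 8 → ∃ λ x → x ≢ 0# × x ∉ xs
  missing-nonzero xs l<8 with Any.any? (λ x → ¬? (x ≟ 0#) ×-dec ¬? (x ∈? xs)) nonzeros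
  ... | yes some = Any.satisfied some
  ... | no none  = ⊥-elim (ℕ.<⇒≢ l<8 (trans (sym (↭-length nonzeros↭xs)) nonzeros-length))
    where
    nonzeros⊆xs : nonzeros ⊆ xs
    nonzeros⊆xs {x} x∈ with x ∈? xs
    ... | yes x∈xs = x∈xs
    ... | no  x∉xs = ⊥-elim (none (lose x∈ (nonzeros-nonzero x∈ , x∉xs)))
    nonzeros↭xs : nonzeros ↭ xs
    nonzeros↭xs = ↭-of-⊆ nonzeros-unique nonzeros⊆xs
      (subst (length xs ℕ.≤_) (sym nonzeros-length) (ℕ.<⇒≤ l<8))

  inv-≢0 : ∀ {x} → x ≢ 0# → inv x ≢ 0#
  inv-≢0 {x} x≢0 eq = 1≢0 (trans (sym (inv-inverse x x≢0)) (trans (cong (x *_) eq) (zeroʳ x)))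

  inv-cancelʳ : ∀ {x y} → x ≢ 0# → y * inv x * x ≡ y
  inv-cancelʳ {x} {y} x≢0 = begin
    y * inv x * x    ≡⟨ solve 3 (λ x y i → y :* i :* x := y :* (x :* i)) refl x y (inv x) ⟩
    y * (x * inv x)  ≡⟨ cong (y *_) (inv-inverse x x≢0) ⟩
    y * 1#           ≡⟨ *-identityʳ y ⟩
    y                ∎

  quotient-≡ : ∀ {a b x y} → x ≢ 0# → y ≢ 0# → a * inv x ≡ b * inv y → a * y ≡ b * x
  quotient-≡ {a} {b} {x} {y} x≢0 y≢0 eq = begin
    a * y                ≡⟨ cong (_* y) (inv-cancelʳ x≢0) ⟨
    a * inv x * x * y    ≡⟨ cong (λ q → q * x * y) eq ⟩
    b * inv y * x * y    ≡⟨ solve 3 (λ q x y → q :* x :* y := q :* y :* x) refl (b * inv y) x y ⟩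
    b * inv y * y * x    ≡⟨ cong (_* x) (inv-cancelʳ y≢0) ⟩
    b * x                ∎

-- Determinants, proportionality, and tangents of an arc

module Plane (K : Field9) where
  open Field9 K
  open FieldSolver K
  open FieldProperties K
  open VectorOps _+_ _*_ -_ public
  open IsCommutativeRing isCommutativeRing using (+-comm; *-assoc; *-identityʳ; +-identityˡ; zeroˡ; zeroʳ)
  open ≡-Reasoning

  V : Set
  V = F × F × F

  0ᵥ : V
  0ᵥ = 0# , 0# , 0#

  -- Expansion of `v` in the basis `P`, `Q`, `R`, cleared of its denominator, with the linear form
  -- `t` applied to it: a line is known from its values at three non-collinear points.
  cramer : ∀ P Q R t v → detᵥ P Q R * dotᵥ t v ≡
    detᵥ Q R v * dotᵥ t P + detᵥ R P v * dotᵥ t Q + detᵥ P Q v * dotᵥ t R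
  cramer (p₁ , p₂ , p₃) (q₁ , q₂ , q₃) (r₁ , r₂ , r₃) (t₁ , t₂ , t₃) (v₁ , v₂ , v₃) =
    solve 15 (λ p₁ p₂ p₃ q₁ q₂ q₃ r₁ r₂ r₃ t₁ t₂ t₃ v₁ v₂ v₃ →
      let P = p₁ , p₂ , p₃ ; Q = q₁ , q₂ , q₃ ; R = r₁ , r₂ , r₃ ; t = t₁ , t₂ , t₃ ; v = v₁ , v₂ , v₃ in
      :det P Q R :* :dot t v := :det Q R v :* :dot t P :+ :det R P v :* :dot t Q :+ :det P Q v :* :dot t R)
      refl p₁ p₂ p₃ q₁ q₂ q₃ r₁ r₂ r₃ t₁ t₂ t₃ v₁ v₂ v₃

  det-rotate : ∀ P Q R → detᵥ P Q R ≡ detᵥ Q R P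
  det-rotate (p₁ , p₂ , p₃) (q₁ , q₂ , q₃) (r₁ , r₂ , r₃) =
    solve 9 (λ p₁ p₂ p₃ q₁ q₂ q₃ r₁ r₂ r₃ →
      let P = p₁ , p₂ , p₃ ; Q = q₁ , q₂ , q₃ ; R = r₁ , r₂ , r₃ in
      :det P Q R := :det Q R P)
      refl p₁ p₂ p₃ q₁ q₂ q₃ r₁ r₂ r₃

  det-repeatʳ : ∀ P Q → detᵥ P Q Q ≡ 0#
  det-repeatʳ (p₁ , p₂ , p₃) (q₁ , q₂ , q₃) =
    solve 6 (λ p₁ p₂ p₃ q₁ q₂ q₃ →
      let P = p₁ , p₂ , p₃ ; Q = q₁ , q₂ , q₃ in :det P Q Q := con o₀)
      refl p₁ p₂ p₃ q₁ q₂ q₃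

  det-repeatˡ : ∀ P Q → detᵥ P Q P ≡ 0#
  det-repeatˡ P Q = trans (det-rotate P Q P) (det-repeatʳ Q P)

  -- The Grassmann-Plücker relation. It factors the difference of the slopes of two lines through
  -- `P` into determinants, which do not vanish on an arc.
  plücker : ∀ P Q R u v →
    detᵥ R P u * detᵥ P Q v ≡ detᵥ R P v * detᵥ P Q u + detᵥ P Q R * detᵥ P u v
  plücker (p₁ , p₂ , p₃) (q₁ , q₂ , q₃) (r₁ , r₂ , r₃) (u₁ , u₂ , u₃) (v₁ , v₂ , v₃) =
    solve 15 (λ p₁ p₂ p₃ q₁ q₂ q₃ r₁ r₂ r₃ u₁ u₂ u₃ v₁ v₂ v₃ →
      let P = p₁ , p₂ , p₃ ; Q = q₁ , q₂ , q₃ ; R = r₁ , r₂ , r₃ ; u = u₁ , u₂ , u₃ ; v = v₁ , v₂ , v₃ in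
      :det R P u :* :det P Q v := :det R P v :* :det P Q u :+ :det P Q R :* :det P u v)
      refl p₁ p₂ p₃ q₁ q₂ q₃ r₁ r₂ r₃ u₁ u₂ u₃ v₁ v₂ v₃

  infix 4 _∥_
  _∥_ : V → V → Set
  v ∥ w = Σ F λ c → c ≢ 0# × v ≡ scaleᵥ c w

  triple-≡ : ∀ {a b c x y z : F} → a ≡ x → b ≡ y → c ≡ z → (a , b , c) ≡ (x , y , z)
  triple-≡ refl refl refl = refl

  scale-zero : ∀ v → scaleᵥ 0# v ≡ 0ᵥ
  scale-zero (x , y , z) = triple-≡ (zeroˡ x) (zeroˡ y) (zeroˡ z)

  coordinate-ratio : ∀ {a b x y} → x ≢ 0# → a * y ≡ b * x → b ≡ a * inv x * y
  coordinate-ratio {a} {b} {x} {y} x≢0 eq = begin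
    b                ≡⟨ *-identityʳ b ⟨
    b * 1#           ≡⟨ cong (b *_) (inv-inverse x x≢0) ⟨
    b * (x * inv x)  ≡⟨ *-assoc b x (inv x) ⟨
    b * x * inv x    ≡⟨ cong (_* inv x) eq ⟨
    a * y * inv x    ≡⟨ solve 3 (λ a y i → a :* y :* i := a :* i :* y) refl a y (inv x) ⟩
    a * inv x * y    ∎

  multiple⇒∥ : ∀ {v w k} → v ≢ 0ᵥ → v ≡ scaleᵥ k w → v ∥ w
  multiple⇒∥ {w = w} v≢0 eq = _ , (λ { refl → v≢0 (trans eq (scale-zero w)) }) , eq

  cross-zero⇒∥ : ∀ {v w} → v ≢ 0ᵥ → w ≢ 0ᵥ → crossᵥ v w ≡ 0ᵥ → v ∥ w
  cross-zero⇒∥ {v@(a , b , c)} {w@(x , y , z)} v≢0 w≢0 eq with x ≟ 0# | y ≟ 0# | z ≟ 0#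
  ... | yes refl | yes refl | yes refl = ⊥-elim (w≢0 refl)
  ... | no x≢0 | _ | _ = multiple⇒∥ v≢0 (triple-≡ (coordinate-ratio x≢0 refl)
      (coordinate-ratio x≢0 (difference-zero (cong (proj₂ ∘ proj₂) eq)))
      (coordinate-ratio x≢0 (sym (difference-zero (cong (proj₁ ∘ proj₂) eq)))))
  ... | yes _ | no y≢0 | _ =
      multiple⇒∥ v≢0 (triple-≡ (coordinate-ratio y≢0 (sym (difference-zero (cong (proj₂ ∘ proj₂) eq))))
      (coordinate-ratio y≢0 refl)
      (coordinate-ratio y≢0 (difference-zero (cong proj₁ eq))))
  ... | yes _ | yes _ | no z≢0 =
      multiple⇒∥ v≢0 (triple-≡ (coordinate-ratio z≢0 (difference-zero (cong (proj₁ ∘ proj₂) eq)))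
      (coordinate-ratio z≢0 (sym (difference-zero (cong proj₁ eq))))
      (coordinate-ratio z≢0 refl))

  dot-scaleˡ : ∀ k t v → dotᵥ (scaleᵥ k t) v ≡ k * dotᵥ t v
  dot-scaleˡ k (t₁ , t₂ , t₃) (v₁ , v₂ , v₃) =
    solve 7 (λ k t₁ t₂ t₃ v₁ v₂ v₃ →
      let t = t₁ , t₂ , t₃ ; v = v₁ , v₂ , v₃ in :dot (:scale k t) v := k :* :dot t v)
      refl k t₁ t₂ t₃ v₁ v₂ v₃

  dot-scaleʳ : ∀ k t v → dotᵥ t (scaleᵥ k v) ≡ k * dotᵥ t v
  dot-scaleʳ k (t₁ , t₂ , t₃) (v₁ , v₂ , v₃) =
    solve 7 (λ k t₁ t₂ t₃ v₁ v₂ v₃ →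
      let t = t₁ , t₂ , t₃ ; v = v₁ , v₂ , v₃ in :dot t (:scale k v) := k :* :dot t v)
      refl k t₁ t₂ t₃ v₁ v₂ v₃

  dot-sub : ∀ k s t v → dotᵥ (subᵥ s (scaleᵥ k t)) v ≡ dotᵥ s v + - (k * dotᵥ t v)
  dot-sub k (s₁ , s₂ , s₃) (t₁ , t₂ , t₃) (v₁ , v₂ , v₃) =
    solve 10 (λ k s₁ s₂ s₃ t₁ t₂ t₃ v₁ v₂ v₃ →
      let s = s₁ , s₂ , s₃ ; t = t₁ , t₂ , t₃ ; v = v₁ , v₂ , v₃ in
      :dot (:sub s (:scale k t)) v := :dot s v :+ :- (k :* :dot t v))
      refl k s₁ s₂ s₃ t₁ t₂ t₃ v₁ v₂ v₃

  ∥-join : ∀ {u v w} → u ∥ w → v ∥ w → u ∥ v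
  ∥-join {w = x , y , z} (c , c≢0 , refl) (d , d≢0 , refl) =
    c * inv d , *-≢0 c≢0 (inv-≢0 d≢0) , triple-≡ (rescale x) (rescale y) (rescale z)
    where
    rescale : ∀ x → c * x ≡ c * inv d * (d * x)
    rescale x = trans (cong (_* x) (sym (inv-cancelʳ d≢0))) (*-assoc (c * inv d) d x)

  dot-∥ : ∀ t {v w} → v ∥ w → dotᵥ t v ≡ 0# → dotᵥ t w ≡ 0#
  dot-∥ t {w = w} (c , c≢0 , refl) eq =
    *-cancelˡ c≢0 (trans (sym (dot-scaleʳ c t w)) (trans eq (sym (zeroʳ c))))

  -- If the determinant vanished, the cross product of `u` and `v` would be a line through all three
  -- points; it is nonzero because `u` and `v` are not proportional.
  pairwise⇒non-collinear : ∀ {u v w} → u ≢ 0ᵥ → v ≢ 0ᵥ → ¬ u ∥ v →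
    (∀ t → t ≢ 0ᵥ → ¬ (dotᵥ t u ≡ 0# × dotᵥ t v ≡ 0# × dotᵥ t w ≡ 0#)) → detᵥ u v w ≢ 0#
  pairwise⇒non-collinear {u} {v} u≢0 v≢0 u∦v no-line det≡0 =
    no-line (crossᵥ u v) (λ eq → u∦v (cross-zero⇒∥ u≢0 v≢0 eq)) (det-repeatˡ u v , det-repeatʳ u v , det≡0)

  record Arc : Set where
    field
      point           : Fin 10 → V
      non-collinear : ∀ {i j k} → i ≢ j → j ≢ k → i ≢ k → detᵥ (point i) (point j) (point k) ≢ 0#

    TangentAt : Fin 10 → V → Set
    TangentAt i t = dotᵥ t (point i) ≡ 0# × (∀ {j} → j ≢ i → dotᵥ t (point j) ≢ 0#)

  module Tangents (O : Arc) where
    open Arc O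

    tangent-scale : ∀ {i t k} → k ≢ 0# → TangentAt i t → TangentAt i (scaleᵥ k t)
    tangent-scale {i} {t} {k} k≢0 (on , off) =
      trans (dot-scaleˡ k t (point i)) (trans (cong (k *_) on) (zeroʳ k)) ,
      λ j≢i → subst (_≢ 0#) (sym (dot-scaleˡ k t _)) (*-≢0 k≢0 (off j≢i))

    module Frame {i j k : Fin 10} {ls : List (Fin 10)} (i≢j : i ≢ j) (j≢k : j ≢ k) (i≢k : i ≢ k)
        (c : Complement i j k ls) where
      open Complement c

      D : F
      D = detᵥ (point i) (point j) (point k)

      -- Up to the common factor `D`, the second and third coordinates of `point l` in the frame of
      -- the points `i`, `j`, `k`. Their ratio is thus the slope of the line joining `point i` to
      -- `point l`.
      y z : Fin 10 → F
      y l = detᵥ (point k) (point i) (point l)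
      z l = detᵥ (point i) (point j) (point l)

      y≢0 : ∀ {l} → l ∈ ls → y l ≢ 0#
      y≢0 l∈ = let l≢i , l≢j , l≢k = sound l∈ in non-collinear (≢-sym i≢k) (≢-sym l≢i) (≢-sym l≢k)

      z≢0 : ∀ {l} → l ∈ ls → z l ≢ 0#
      z≢0 l∈ = let l≢i , l≢j , l≢k = sound l∈ in non-collinear i≢j (≢-sym l≢j) (≢-sym l≢i)

      ratio : Fin 10 → F
      ratio l = y l * inv (z l)

      -- The lines joining point i to the other points are distinct.
      ratios-unique : ∀ {ms} → Unique ms → ms ⊆ ls → Unique (map ratio ms)
      ratios-unique [] _ = []
      ratios-unique {m ∷ ms} (m∉ms ∷ ms!) ms⊆ =
          All.map⁺ (All.tabulate ratio≢) ∷ ratios-unique ms! (ms⊆ ∘ there)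
        where
        ratio≢ : ∀ {l} → l ∈ ms → ratio m ≢ ratio l
        ratio≢ {l} l∈ eq = *-≢0 (non-collinear i≢j j≢k i≢k)
          (non-collinear (≢-sym (proj₁ (sound (ms⊆ (here refl))))) (All.lookup m∉ms l∈) (≢-sym (proj₁ (sound
              (ms⊆ (there l∈))))))
          (cancel (sym (quotient-≡ (z≢0 (ms⊆ (here refl))) (z≢0 (ms⊆ (there l∈))) eq))
            (trans (trans (+-comm _ _) (sym (plücker _ _ _ _ _))) (sym (+-identityˡ _))))

      ratios-nonzero : All (_≢ 0#) (map ratio ls)
      ratios-nonzero = All.map⁺ (All.tabulate λ l∈ → *-≢0 (y≢0 l∈) (inv-≢0 (z≢0 l∈)))

      through-point : ∀ {t} → dotᵥ t (point i) ≡ 0# → ∀ v → D * dotᵥ t v ≡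
        detᵥ (point k) (point i) v * dotᵥ t (point j) + detᵥ (point i) (point j) v * dotᵥ t (point k)
      through-point {t} on v = begin
        D * dotᵥ t v  ≡⟨ cramer (point i) (point j) (point k) t v ⟩
        x * dotᵥ t (point i) + y′ * dotᵥ t (point j) + z′ * dotᵥ t (point k)
          ≡⟨ cong (λ e → x * e + y′ * dotᵥ t (point j) + z′ * dotᵥ t (point k)) on ⟩
        x * 0# + y′ * dotᵥ t (point j) + z′ * dotᵥ t (point k)
          ≡⟨ solve 3 (λ x y z → x :* con o₀ :+ y :+ z := y :+ z) refl x _ _ ⟩
        y′ * dotᵥ t (point j) + z′ * dotᵥ t (point k)  ∎
        where
        x y′ z′ : F
        x = detᵥ (point j) (point k) v
        y′ = detᵥ (point k) (point i) v
        z′ = detᵥ (point i) (point j) v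

      -- The heart of Segre's argument. The tangent has slope `κ`, by `through-point`; it misses the
      -- seven other points, so `κ` and their seven slopes are eight distinct nonzero elements, with
      -- product -1. Solving for the ratio of the values of `t` at `j` and `k` gives an expression
      -- in the points alone.
      tangent-ratio : ∀ {t} → TangentAt i t →
        ∏ (map y ls) * dotᵥ t (point k) ≡ ∏ (map z ls) * dotᵥ t (point j)
      tangent-ratio {t} (on , off) = begin
        Y * tₖ                      ≡⟨ cong (_* tₖ) (∏-quotient y z z≢0) ⟨
        R * Z * tₖ                  ≡⟨ solve 3 (λ R Z t → R :* Z :* t := Z :* (R :* t)) refl R Z tₖ ⟩
        Z * (R * tₖ)                ≡⟨ cong (Z *_) R*tₖ ⟩
        Z * tⱼ                      ∎
        where
        tⱼ tₖ Y Z R κ : F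
        tⱼ = dotᵥ t (point j)
        tₖ = dotᵥ t (point k)
        Y = ∏ (map y ls)
        Z = ∏ (map z ls)
        R = ∏ (map ratio ls)
        κ = - tₖ * inv tⱼ
        tⱼ≢0 : tⱼ ≢ 0#
        tⱼ≢0 = off (≢-sym i≢j)
        κ≢0 : κ ≢ 0#
        κ≢0 = *-≢0 (neg-≢0 (off (≢-sym i≢k))) (inv-≢0 tⱼ≢0)
        κ≢ratio : ∀ {l} → l ∈ ls → κ ≢ ratio l
        κ≢ratio {l} l∈ eq = *-≢0 (non-collinear i≢j j≢k i≢k) (off (proj₁ (sound l∈)))
          (trans (through-point on (point l)) (cancel (quotient-≡ tⱼ≢0 (z≢0 l∈) eq)
            (solve 4 (λ y z a b → y :* a :+ z :* b :+ :- b :* z := con o₀ :+ y :* a) refl (y l) (z l) tⱼ tₖ)))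
        product : κ * R ≡ - 1#
        product = ∏-eight (All.map⁺ (All.tabulate κ≢ratio) ∷ ratios-unique unique (λ l∈ → l∈))
          (κ≢0 ∷ ratios-nonzero) (cong suc (trans (List.length-map ratio ls) size))
        R*tₖ : R * tₖ ≡ tⱼ
        R*tₖ = begin
          R * tₖ                          ≡⟨ cong (R *_) (inv-cancelʳ tⱼ≢0) ⟨
          R * (tₖ * inv tⱼ * tⱼ)
              ≡⟨ solve 4 (λ R t i s → R :* (t :* i :* s) := :- t :* i :* R :* :- s) refl R tₖ (inv tⱼ) tⱼ ⟩
          κ * R * - tⱼ                    ≡⟨ cong (_* - tⱼ) product ⟩
          - 1# * - tⱼ                     ≡⟨ solve 1 (λ t → :- con o₁ :* :- t := t) refl tⱼ ⟩
          tⱼ                              ∎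

-- Segre's theorem: ovals are conics

module Segre (K : Field9) where
  open Field9 K
  open FieldSolver K
  open FieldProperties K
  open Plane K
  open IsCommutativeRing isCommutativeRing using (*-comm; *-assoc; +-identityˡ; zeroʳ)
  open ≡-Reasoning

  combine : F → V → F → V → F → V → V
  combine x (r₁ , r₂ , r₃) y (s₁ , s₂ , s₃) z (t₁ , t₂ , t₃) =
    x * r₁ + y * s₁ + z * t₁ , x * r₂ + y * s₂ + z * t₂ , x * r₃ + y * s₃ + z * t₃

  dot-combine : ∀ x r y s z t v →
    dotᵥ (combine x r y s z t) v ≡ x * dotᵥ r v + y * dotᵥ s v + z * dotᵥ t v
  dot-combine x (r₁ , r₂ , r₃) y (s₁ , s₂ , s₃) z (t₁ , t₂ , t₃) (v₁ , v₂ , v₃) =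
    solve 15 (λ x y z r₁ r₂ r₃ s₁ s₂ s₃ t₁ t₂ t₃ v₁ v₂ v₃ →
      let r = r₁ , r₂ , r₃ ; s = s₁ , s₂ , s₃ ; t = t₁ , t₂ , t₃ ; v = v₁ , v₂ , v₃ in
      :dot (x :* r₁ :+ y :* s₁ :+ z :* t₁ , x :* r₂ :+ y :* s₂ :+ z :* t₂ , x :* r₃ :+ y :* s₃ :+ z :* t₃) v
        := x :* :dot r v :+ y :* :dot s v :+ z :* :dot t v)
      refl x y z r₁ r₂ r₃ s₁ s₂ s₃ t₁ t₂ t₃ v₁ v₂ v₃

  module Ovals (O : Arc) where
    open Arc O
    open Tangents O

    _at_ : V → Fin 10 → F
    t at l = dotᵥ t (point l)

    -- Multiply `tangent-ratio` over the three vertices. The determinants belonging to one side of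
    -- the triangle occur at both of its ends, so each of `X`, `Y`, `Z` appears once on either side
    -- and cancels.
    lemma-of-tangents : ∀ {i j k r s t} → i ≢ j → j ≢ k → i ≢ k →
      TangentAt i r → TangentAt j s → TangentAt k t →
      (r at j) * (s at k) * (t at i) ≡ (r at k) * (s at i) * (t at j)
    lemma-of-tangents {i} {j} {k} {r} {s} {t} i≢j j≢k i≢k Tr Ts Tt
      with ls , c ← complement i≢j j≢k i≢k = *-cancelˡ (*-≢0 (*-≢0 X≢0 Y≢0) Z≢0) (begin
        X * Y * Z * ((r at j) * (s at k) * (t at i))
          ≡⟨ solve 6 (λ X Y Z a b c → X :* Y :* Z :* (a :* b :* c)
              := Z :* a :* (X :* b) :* (Y :* c)) refl X Y Z _ _ _ ⟩
        Z * (r at j) * (X * (s at k)) * (Y * (t at i))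
          ≡⟨ cong₂ _*_ (cong₂ _*_ (Fᵢ.tangent-ratio Tr) (Fⱼ.tangent-ratio Ts)) (Fₖ.tangent-ratio Tt) ⟨
        Y * (r at k) * (Z * (s at i)) * (X * (t at j))
          ≡⟨ solve 6 (λ X Y Z a b c → X :* Y :* Z :* (a :* b :* c)
              := Y :* a :* (Z :* b) :* (X :* c)) refl X Y Z _ _ _ ⟨
        X * Y * Z * ((r at k) * (s at i) * (t at j)) ∎)
      where
      module Fᵢ = Frame i≢j j≢k i≢k c
      module Fⱼ = Frame j≢k (≢-sym i≢k) (≢-sym i≢j) (rotate c)
      module Fₖ = Frame (≢-sym i≢k) i≢j (≢-sym j≢k) (rotate (rotate c))
      X Y Z : F
      X = ∏ (map Fₖ.y ls)
      Y = ∏ (map Fᵢ.y ls)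
      Z = ∏ (map Fⱼ.y ls)
      X≢0 : X ≢ 0#
      X≢0 = ∏-nonzero Fₖ.y Fₖ.y≢0
      Y≢0 : Y ≢ 0#
      Y≢0 = ∏-nonzero Fᵢ.y Fᵢ.y≢0
      Z≢0 : Z ≢ 0#
      Z≢0 = ∏-nonzero Fⱼ.y Fⱼ.y≢0

    -- The seven other points occupy seven of the eight nonzero slopes at `point i`, and `j` and `k`
    -- the two degenerate ones; the line with the slope left over is the tangent.
    tangent-exists : ∀ i → ∃ (TangentAt i)
    tangent-exists i with two-others i
    ... | j , k , i≢j , j≢k , i≢k with complement i≢j j≢k i≢k
    ... | ls , c = build (missing-nonzero (map ratio ls) (ℕ.≤-reflexive (cong suc
        (trans (List.length-map ratio ls) (Complement.size c)))))
      where
      open Frame i≢j j≢k i≢k c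
      build : (∃ λ κ → κ ≢ 0# × κ ∉ map ratio ls) → ∃ (TangentAt i)
      build (κ , κ≢0 , κ∉) = t , on , off
        where
        t : V
        -- The line where y = κ z in frame coordinates, that is, the line of slope `κ` through
        -- `point i`.
        t = subᵥ (crossᵥ (point k) (point i)) (scaleᵥ κ (crossᵥ (point i) (point j)))
        t-at : ∀ l → t at l ≡ y l + - (κ * z l)
        t-at l = dot-sub κ (crossᵥ (point k) (point i)) (crossᵥ (point i) (point j)) (point l)
        on : t at i ≡ 0#
        on = trans (t-at i) (trans (cong₂ (λ y z → y + - (κ * z)) (det-repeatʳ _ _) (det-repeatˡ _ _))
          (solve 1 (λ κ → con o₀ :+ :- (κ :* con o₀) := con o₀) refl κ))
        D≢0 : D ≢ 0#
        D≢0 = non-collinear i≢j j≢k i≢k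
        off : ∀ {l} → l ≢ i → t at l ≢ 0#
        off {l} l≢i with l Fin.≟ j | l Fin.≟ k
        ... | yes refl | _ = subst (_≢ 0#) (sym (begin
          t at l                  ≡⟨ t-at l ⟩
          y l + - (κ * z l)       ≡⟨ cong₂ (λ y z → y + - (κ * z)) (det-rotate _ _ _) (det-repeatʳ _ _) ⟩
          D + - (κ * 0#)          ≡⟨ solve 2 (λ D κ → D :+ :- (κ :* con o₀) := D) refl D κ ⟩
          D                       ∎)) D≢0
        ... | no _ | yes refl = subst (_≢ 0#) (sym (begin
          t at l                  ≡⟨ t-at l ⟩
          y l + - (κ * z l)       ≡⟨ cong (λ y → y + - (κ * z l)) (det-repeatˡ _ _) ⟩
          0# + - (κ * D)          ≡⟨ +-identityˡ _ ⟩
          - (κ * D)               ∎)) (neg-≢0 (*-≢0 κ≢0 D≢0))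
        ... | no l≢j | no l≢k = λ eq → κ∉ (subst (_∈ map ratio ls) (begin
          y l * inv (z l)         ≡⟨ cong (_* inv (z l)) (difference-zero (trans (sym (t-at l)) eq)) ⟩
          κ * z l * inv (z l)     ≡⟨ solve 3 (λ κ z i → κ :* z :* i := κ :* i :* z) refl κ (z l) (inv (z l)) ⟩
          κ * inv (z l) * z l     ≡⟨ inv-cancelʳ (z≢0 l∈) ⟩
          κ                       ∎) (∈-map⁺ ratio l∈))
          where
          l∈ : l ∈ ls
          l∈ = Complement.complete c l≢i l≢j l≢k

    -- By `tangent-ratio` the ratio of the values at `j` and `k` is the same for both tangents, and
    -- a line through `point i` is determined by that ratio.
    tangent-unique : ∀ {i s t} → TangentAt i s → TangentAt i t → ∀ v → dotᵥ s v ≡ 0# → dotᵥ t v ≡ 0#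
    tangent-unique {i} {s} {t} Ts Tt v s⊥v
      with j , k , i≢j , j≢k , i≢k ← two-others i with ls , c ← complement i≢j j≢k i≢k =
      *-cancelˡ (*-≢0 (non-collinear i≢j j≢k i≢k) (proj₂ Ts (≢-sym i≢j))) (begin
        D * (s at j) * dotᵥ t v               ≡⟨ solve 3 (λ D s t → D :* s :* t := s :* (D :* t)) refl D _ _ ⟩
        (s at j) * (D * dotᵥ t v)             ≡⟨ cong ((s at j) *_) (through-point (proj₁ Tt) v) ⟩
        (s at j) * (y′ * (t at j) + z′ * (t at k))
          ≡⟨ cancel proportional (solve 6 (λ y z s t s′ t′ → s :* (y :* t :+ z :* t′) :+ z :* (s′ :* t)
              := t :* (y :* s :+ z :* s′) :+ z :* (s :* t′)) refl y′ z′ _ _ _ _) ⟩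
        (t at j) * (y′ * (s at j) + z′ * (s at k)) ≡⟨ cong ((t at j) *_) (through-point (proj₁ Ts) v) ⟨
        (t at j) * (D * dotᵥ s v)             ≡⟨ cong (λ e → (t at j) * (D * e)) s⊥v ⟩
        (t at j) * (D * 0#)
            ≡⟨ solve 3 (λ D s t → t :* (D :* con o₀) := D :* s :* con o₀) refl D (s at j) (t at j) ⟩
        D * (s at j) * 0#                     ∎)
      where
      open Frame i≢j j≢k i≢k c
      y′ z′ Y Z : F
      y′ = detᵥ (point k) (point i) v
      z′ = detᵥ (point i) (point j) v
      Y = ∏ (map y ls)
      Z = ∏ (map z ls)
      proportional : z′ * ((s at k) * (t at j)) ≡ z′ * ((s at j) * (t at k))
      proportional = cong (z′ *_) (*-cancelˡ (∏-nonzero y y≢0) (begin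
        Y * ((s at k) * (t at j))   ≡⟨ *-assoc Y _ _ ⟨
        Y * (s at k) * (t at j)     ≡⟨ cong (_* (t at j)) (tangent-ratio Ts) ⟩
        Z * (s at j) * (t at j)     ≡⟨ solve 3 (λ Z a b → Z :* a :* b := Z :* b :* a) refl Z _ _ ⟩
        Z * (t at j) * (s at j)     ≡⟨ cong (_* (s at j)) (tangent-ratio Tt) ⟨
        Y * (t at k) * (s at j)     ≡⟨ solve 3 (λ Y a b → Y :* a :* b := Y :* (b :* a)) refl Y _ _ ⟩
        Y * ((s at j) * (t at k))   ∎))

    -- The lemma of tangents makes this normalisation consistent; it turns the matrix of the values
    -- of tangents at points into that of a symmetric bilinear form, whose conic is the oval.
    record SymmetricTriple (i j k : Fin 10) (r s t : V) : Set where
      field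
        i≢j : i ≢ j
        j≢k : j ≢ k
        i≢k : i ≢ k
        Tr  : TangentAt i r
        Ts  : TangentAt j s
        Tt  : TangentAt k t
        rs  : r at j ≡ s at i
        rt  : r at k ≡ t at i
        st  : s at k ≡ t at j

    -- The two scalars are chosen to make `rs` and `rt` true; the remaining equation `st` is then
    -- exactly what the lemma of tangents provides.
    symmetrize : ∀ {i j k r s t} → i ≢ j → j ≢ k → i ≢ k →
      TangentAt i r → TangentAt j s → TangentAt k t →
      ∃ λ c → ∃ λ d → SymmetricTriple i j k r (scaleᵥ c s) (scaleᵥ d t)
    symmetrize {i} {j} {k} {r} {s} {t} i≢j j≢k i≢k Tr Ts Tt = c , d , record
      { i≢j = i≢j ; j≢k = j≢k ; i≢k = i≢k ; Tr = Tr ; Ts = Ts′ ; Tt = Tt′ ; rs = rs ; rt = rt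
      ; st = *-cancelˡ (*-≢0 (proj₂ Tr (≢-sym i≢j)) (proj₂ Tr (≢-sym i≢k))) (begin
          (r at j) * (r at k) * (s′ at k)
              ≡⟨ solve 3 (λ a b x → a :* b :* x := a :* x :* b) refl (r at j) (r at k) (s′ at k) ⟩
          (r at j) * (s′ at k) * (r at k)   ≡⟨ cong ((r at j) * (s′ at k) *_) rt ⟩
          (r at j) * (s′ at k) * (t′ at i)  ≡⟨ lemma-of-tangents i≢j j≢k i≢k Tr Ts′ Tt′ ⟩
          (r at k) * (s′ at i) * (t′ at j)  ≡⟨ cong (λ e → (r at k) * e * (t′ at j)) rs ⟨
          (r at k) * (r at j) * (t′ at j)   ≡⟨ cong (_* (t′ at j)) (*-comm (r at k) (r at j)) ⟩
          (r at j) * (r at k) * (t′ at j)   ∎) }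
      where
      c d : F
      c = (r at j) * inv (s at i)
      d = (r at k) * inv (t at i)
      s′ t′ : V
      s′ = scaleᵥ c s
      t′ = scaleᵥ d t
      Ts′ : TangentAt j s′
      Ts′ = tangent-scale (*-≢0 (proj₂ Tr (≢-sym i≢j)) (inv-≢0 (proj₂ Ts i≢j))) Ts
      Tt′ : TangentAt k t′
      Tt′ = tangent-scale (*-≢0 (proj₂ Tr (≢-sym i≢k)) (inv-≢0 (proj₂ Tt i≢k))) Tt
      rs : r at j ≡ s′ at i
      rs = sym (trans (dot-scaleˡ c s (point i)) (inv-cancelʳ (proj₂ Ts i≢j)))
      rt : r at k ≡ t′ at i
      rt = sym (trans (dot-scaleˡ d t (point i)) (inv-cancelʳ (proj₂ Tt i≢k)))

    -- A lemma of tangents with one symmetry already cancelled. It also covers a contact point `l`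
    -- equal to `m` or `n`, where both sides vanish. Its instances are the 2×2 minors needed in
    -- `tangent-polar`.
    tangent-pair : ∀ {m n l s r t} → m ≢ n → TangentAt m s → TangentAt n r → s at n ≡ r at m →
      TangentAt l t → (s at l) * (t at n) ≡ (r at l) * (t at m)
    tangent-pair {m} {n} {l} {s} {r} {t} m≢n Ts Tr sr Tt with l Fin.≟ m | l Fin.≟ n
    ... | yes refl | _ = trans (cong (_* (t at n)) (proj₁ Ts))
      (trans (solve 2 (λ a b → con o₀ :* a
          := b :* con o₀) refl (t at n) (r at l)) (cong ((r at l) *_) (sym (proj₁ Tt))))
    ... | no _ | yes refl = trans (cong ((s at l) *_) (proj₁ Tt))
      (trans (solve 2 (λ a b → a :* con o₀
          := con o₀ :* b) refl (s at l) (t at m)) (cong (_* (t at m)) (sym (proj₁ Tr))))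
    ... | no l≢m | no l≢n = *-cancelˡ (proj₂ Tr m≢n) (begin
      (r at m) * ((s at l) * (t at n))
          ≡⟨ solve 3 (λ a b c → a :* (b :* c) := b :* a :* c) refl (r at m) (s at l) (t at n) ⟩
      (s at l) * (r at m) * (t at n)    ≡⟨ lemma-of-tangents m≢n (≢-sym l≢n) (≢-sym l≢m) Ts Tr Tt ⟨
      (s at n) * (r at l) * (t at m)    ≡⟨ cong (λ e → e * (r at l) * (t at m)) sr ⟩
      (r at m) * (r at l) * (t at m)    ≡⟨ *-assoc (r at m) (r at l) (t at m) ⟩
      (r at m) * ((r at l) * (t at m))  ∎)

    module SymmetricFrame {i j k : Fin 10} {r s t : V} (T : SymmetricTriple i j k r s t) where
      open SymmetricTriple T

      D a b c : F
      D = detᵥ (point i) (point j) (point k)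
      a = s at k
      b = r at k
      c = r at j

      D≢0 : D ≢ 0#
      D≢0 = non-collinear i≢j j≢k i≢k
      a≢0 : a ≢ 0#
      a≢0 = proj₂ Ts (≢-sym j≢k)
      b≢0 : b ≢ 0#
      b≢0 = proj₂ Tr (≢-sym i≢k)
      c≢0 : c ≢ 0#
      c≢0 = proj₂ Tr (≢-sym i≢j)

      x y z : V → F
      x v = detᵥ (point j) (point k) v
      y v = detᵥ (point k) (point i) v
      z v = detᵥ (point i) (point j) v

      frame-cramer : ∀ q v → D * dotᵥ q v ≡ x v * (q at i) + y v * (q at j) + z v * (q at k)
      frame-cramer = cramer (point i) (point j) (point k)

      -- The polarity of the symmetric form whose matrix in the frame has zero diagonal and the
      -- entries `a`, `b`, `c` off it; it sends the three reference points to multiples of `r`, `s`,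
      -- `t`.
      polar : V → V
      polar v = combine (x v) r (y v) s (z v) t

      dot-polar : ∀ u v → dotᵥ (polar u) v ≡ x u * dotᵥ r v + y u * dotᵥ s v + z u * dotᵥ t v
      dot-polar u = dot-combine (x u) r (y u) s (z u) t

      polar-i : ∀ v → polar v at i ≡ D * dotᵥ r v
      polar-i v = trans (dot-polar v (point i))
        (trans (cong₂ (λ e f → x v * (r at i) + y v * e + z v * f) (sym rs) (sym rt)) (sym
            (frame-cramer r v)))

      polar-j : ∀ v → polar v at j ≡ D * dotᵥ s v
      polar-j v = trans (dot-polar v (point j))
        (trans (cong₂ (λ e f → x v * e + y v * (s at j) + z v * f) rs (sym st)) (sym (frame-cramer s v)))

      polar-k : ∀ v → polar v at k ≡ D * dotᵥ t v
      polar-k v = trans (dot-polar v (point k))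
        (trans (cong₂ (λ e f → x v * e + y v * f + z v * (t at k)) rt st) (sym (frame-cramer t v)))

      -- Two linear forms are compared at the three frame points. The values `τ` of the tangent
      -- there are proportional to the values `σ` of the reference tangents at `point l`, by
      -- `tangent-pair`; by symmetry of the form, `σ` also gives the values of the polar.
      tangent-polar : ∀ {l q} → TangentAt l q →
        ∃ λ κ → κ ≢ 0# × ∀ v → κ * dotᵥ q v ≡ dotᵥ (polar (point l)) v
      tangent-polar {l} {q} Tq = D * κ , *-≢0 D≢0 κ≢0 , λ v → *-cancelˡ D≢0 (begin
          D * (D * κ * dotᵥ q v)
            ≡⟨ solve 3 (λ D κ e → D :* (D :* κ :* e) := D :* κ :* (D :* e)) refl D κ (dotᵥ q v) ⟩
          D * κ * (D * dotᵥ q v)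
            ≡⟨ cong (D * κ *_) (frame-cramer q v) ⟩
          D * κ * (x v * (q at i) + y v * (q at j) + z v * (q at k))
            ≡⟨ solve 8 (λ D κ x y z a b c → D :* κ :* (x :* a :+ y :* b :+ z :* c)
                := x :* (D :* (κ :* a)) :+ y :* (D :* (κ :* b)) :+ z :* (D :* (κ :* c)))
                refl D κ (x v) (y v) (z v) (q at i) (q at j) (q at k) ⟩
          x v * (D * (κ * (q at i))) + y v * (D * (κ * (q at j))) + z v * (D * (κ * (q at k)))
            ≡⟨ cong₂ _+_ (cong₂ (λ e f → x v * e + y v * f)
                 (trans (polar-i (point l)) (cong (D *_) (cong proj₁ σ≡)))
                 (trans (polar-j (point l)) (cong (D *_) (cong (proj₁ ∘ proj₂) σ≡))))
                 (cong (z v *_) (trans (polar-k (point l)) (cong (D *_) (cong (proj₂ ∘ proj₂) σ≡)))) ⟨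
          x v * (polar (point l) at i) + y v * (polar (point l) at j) + z v * (polar (point l) at k)
            ≡⟨ frame-cramer (polar (point l)) v ⟨
          D * dotᵥ (polar (point l)) v ∎)
        where
        σ τ : V
        σ = r at l , s at l , t at l
        τ = q at i , q at j , q at k
        σ≢0 : σ ≢ 0ᵥ
        σ≢0 σ≡0 with l Fin.≟ i
        ... | yes refl = proj₂ Ts i≢j (cong (proj₁ ∘ proj₂) σ≡0)
        ... | no l≢i = proj₂ Tr l≢i (cong proj₁ σ≡0)
        τ≢0 : τ ≢ 0ᵥ
        τ≢0 τ≡0 with l Fin.≟ i
        ... | yes refl = proj₂ Tq (≢-sym i≢j) (cong (proj₁ ∘ proj₂) τ≡0)
        ... | no l≢i = proj₂ Tq (≢-sym l≢i) (cong proj₁ τ≡0)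
        minor : ∀ {a b c d : F} → a * b ≡ c * d → a * b + - (c * d) ≡ 0#
        minor {c = c} {d} eq = trans (cong (_+ - (c * d)) eq) (solve 1 (λ e → e :+ :- e
            := con o₀) refl (c * d))
        σ∥τ : σ ∥ τ
        σ∥τ = cross-zero⇒∥ σ≢0 τ≢0 (triple-≡
          (minor (tangent-pair j≢k Ts Tt st Tq))
          (minor (tangent-pair (≢-sym i≢k) Tt Tr (sym rt) Tq))
          (minor (tangent-pair i≢j Tr Ts rs Tq)))
        κ : F
        κ = proj₁ σ∥τ
        κ≢0 : κ ≢ 0#
        κ≢0 = proj₁ (proj₂ σ∥τ)
        σ≡ : σ ≡ scaleᵥ κ τ
        σ≡ = proj₂ (proj₂ σ∥τ)

      -- Each point lies on its own tangent, which is its polar, so the quadratic form of the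
      -- polarity vanishes at it.
      conic : ∀ l → let v = point l in
        a * (y v * z v) + b * (z v * x v) + c * (x v * y v) ≡ 0#
      conic l = begin
        a * (y v * z v) + b * (z v * x v) + c * (x v * y v)
          -- The form contains every mixed term twice, and 2 = -1 in characteristic 3.
          ≡⟨ solve 7 (λ a b c x y z o → a :* (y :* z) :+ b :* (z :* x) :+ c :* (x :* y)
               := :- (x :* (y :* c :+ z :* b) :+ y :* (x :* c :+ z :* a) :+ z :* (x :* b :+ y :* a)))
                   refl a b c (x v) (y v) (z v) 0# ⟩
        - (x v * (y v * c + z v * b) + y v * (x v * c + z v * a) + z v * (x v * b + y v * a))
          ≡⟨ cong -_ (cong₂ _+_ (cong₂ (λ e f → x v * e + y v * f) (sym Dr) (sym Ds))
              (cong (z v *_) (sym Dt))) ⟩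
        - (x v * (D * dotᵥ r v) + y v * (D * dotᵥ s v) + z v * (D * dotᵥ t v))
          ≡⟨ solve 7 (λ D x y z r s t → :- (x :* (D :* r) :+ y :* (D :* s) :+ z :* (D :* t))
              := :- (D :* (x :* r :+ y :* s :+ z :* t)))
              refl D (x v) (y v) (z v) (dotᵥ r v) (dotᵥ s v) (dotᵥ t v) ⟩
        - (D * (x v * dotᵥ r v + y v * dotᵥ s v + z v * dotᵥ t v))
          ≡⟨ cong (λ e → - (D * e)) (trans (sym (dot-polar v v)) polar-self) ⟩
        - (D * 0#)
          ≡⟨ solve 1 (λ D → :- (D :* con o₀) := con o₀) refl D ⟩
        0# ∎
        where
        v : V
        v = point l
        polar-self : dotᵥ (polar v) v ≡ 0#
        polar-self = let Tq = proj₂ (tangent-exists l) ; κ , _ , polar≡ = tangent-polar Tq in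
          trans (sym (polar≡ v)) (trans (cong (κ *_) (proj₁ Tq)) (zeroʳ κ))
        Dr : D * dotᵥ r v ≡ y v * c + z v * b
        Dr = trans (frame-cramer r v) (trans (cong (λ e → x v * e + y v * c + z v * b) (proj₁ Tr))
          (solve 3 (λ x y z → x :* con o₀ :+ y :+ z := y :+ z) refl (x v) (y v * c) (z v * b)))
        Ds : D * dotᵥ s v ≡ x v * c + z v * a
        Ds = trans (frame-cramer s v) (trans (cong₂ (λ e f → x v * f + y v * e + z v * a) (proj₁ Ts) (sym rs))
          (solve 3 (λ x y z → x :+ y :* con o₀ :+ z := x :+ z) refl (x v * c) (y v) (z v * a)))
        Dt : D * dotᵥ t v ≡ x v * b + y v * a
        Dt = trans (frame-cramer t v)
            (trans (cong₂ (λ e f → x v * f + y v * (t at j) + z v * e) (proj₁ Tt) (sym rt))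
          (trans (cong (λ e → x v * b + y v * e + z v * 0#) (sym st))
          (solve 3 (λ x y z → x :+ y :+ z :* con o₀ := x :+ y) refl (x v * b) (y v * a) (z v))))

-- Normal form of a pair of ovals with a path of three edges

module NormalForms (K : Field9) where
  open Field9 K
  open FieldSolver K
  open FieldProperties K
  open Plane K
  open Segre K
  open IsCommutativeRing isCommutativeRing using (*-assoc; zeroʳ)
  open ≡-Reasoning

  -- The expansion of the triple product, (v × w) × l = (l · v) w - (l · w) v: a line through both
  -- points is proportional to their join.
  double-cross : ∀ l v w → dotᵥ l v ≡ 0# → dotᵥ l w ≡ 0# → crossᵥ (crossᵥ v w) l ≡ 0ᵥ
  double-cross (l₁ , l₂ , l₃) (v₁ , v₂ , v₃) (w₁ , w₂ , w₃) lv lw = triple-≡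
    (cancel (sym (cong₂ (λ e f → w₁ * e + - (v₁ * f)) lv lw)) (solve 9 (λ l₁ l₂ l₃ v₁ v₂ v₃ w₁ w₂ w₃ →
      let l = l₁ , l₂ , l₃ ; v = v₁ , v₂ , v₃ ; w = w₁ , w₂ , w₃ in
      proj₁ (:cross (:cross v w) l) :+ (w₁ :* con o₀ :+ :- (v₁ :* con o₀))
          := con o₀ :+ (w₁ :* :dot l v :+ :- (v₁ :* :dot l w))) refl l₁ l₂ l₃ v₁ v₂ v₃ w₁ w₂ w₃))
    (cancel (sym (cong₂ (λ e f → w₂ * e + - (v₂ * f)) lv lw)) (solve 9 (λ l₁ l₂ l₃ v₁ v₂ v₃ w₁ w₂ w₃ →
      let l = l₁ , l₂ , l₃ ; v = v₁ , v₂ , v₃ ; w = w₁ , w₂ , w₃ in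
      proj₁ (proj₂ (:cross (:cross v w) l)) :+ (w₂ :* con o₀ :+ :- (v₂ :* con o₀))
          := con o₀ :+ (w₂ :* :dot l v :+ :- (v₂ :* :dot l w))) refl l₁ l₂ l₃ v₁ v₂ v₃ w₁ w₂ w₃))
    (cancel (sym (cong₂ (λ e f → w₃ * e + - (v₃ * f)) lv lw)) (solve 9 (λ l₁ l₂ l₃ v₁ v₂ v₃ w₁ w₂ w₃ →
      let l = l₁ , l₂ , l₃ ; v = v₁ , v₂ , v₃ ; w = w₁ , w₂ , w₃ in
      proj₂ (proj₂ (:cross (:cross v w) l)) :+ (w₃ :* con o₀ :+ :- (v₃ :* con o₀))
          := con o₀ :+ (w₃ :* :dot l v :+ :- (v₃ :* :dot l w))) refl l₁ l₂ l₃ v₁ v₂ v₃ w₁ w₂ w₃))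

  cross-scale : ∀ c v d w → crossᵥ (scaleᵥ c v) (scaleᵥ d w) ≡ scaleᵥ (c * d) (crossᵥ v w)
  cross-scale c (v₁ , v₂ , v₃) d (w₁ , w₂ , w₃) =
      triple-≡ (minor v₂ v₃ w₂ w₃) (minor v₃ v₁ w₃ w₁) (minor v₁ v₂ w₁ w₂)
    where
    minor : ∀ v v′ w w′ → (c * v) * (d * w′) + - ((c * v′) * (d * w)) ≡ (c * d) * (v * w′ + - (v′ * w))
    minor = solve 6 (λ c d v v′ w w′ → (c :* v) :* (d :* w′) :+ :- ((c :* v′) :* (d :* w))
        := (c :* d) :* (v :* w′ :+ :- (v′ :* w))) refl c d

  envelope-scale : ∀ θ β γ k l → envelopeᵥ θ β γ (scaleᵥ k l) ≡ k * k * envelopeᵥ θ β γ l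
  envelope-scale θ β γ k (l₁ , l₂ , l₃) = solve 7 (λ θ β γ k l₁ l₂ l₃ →
    let l = l₁ , l₂ , l₃ in :envelope θ β γ (:scale k l) := k :* k :* :envelope θ β γ l) refl θ β γ k l₁ l₂ l₃

  module _ (T O : Arc) where
    open Arc O
    open Arc T using () renaming (point to pointᵀ; TangentAt to TangentAtᵀ)
    module 𝕆 = Ovals O
    module 𝕋 = Ovals T

    Edge : Fin 10 → Fin 10 → Set
    Edge l m = Σ V λ t → ∃ λ k → TangentAtᵀ k t × dotᵥ t (point l) ≡ 0# × dotᵥ t (point m) ≡ 0#

    record NormalForm : Set where
      field
        X        : Fin 10 → V
        X≢0      : ∀ l → X l ≢ 0ᵥ
        X-∦      : ∀ {l m} → l ≢ m → ¬ X l ∥ X m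
        on-conic : ∀ l → conicᵥ (X l) ≡ 0#
        θ β γ    : F
        θ≢0      : θ ≢ 0#
        β≢0      : β ≢ 0#
        γ≢0      : γ ≢ 0#
        edge     : ∀ {l m} → l ≢ m → Edge l m → envelopeᵥ θ β γ (crossᵥ (X l) (X m)) ≡ 0#

      edge-∥ : ∀ {l m v w} → l ≢ m → Edge l m → X l ∥ v → X m ∥ w → envelopeᵥ θ β γ (crossᵥ v w) ≡ 0#
      edge-∥ {l} {m} {v} {w} l≢m e (c , c≢0 , Xl≡) (d , d≢0 , Xm≡) =
        *-cancelˡ (*-≢0 (*-≢0 c≢0 d≢0) (*-≢0 c≢0 d≢0)) (begin
          c * d * (c * d) * envelopeᵥ θ β γ (crossᵥ v w)       ≡⟨ envelope-scale θ β γ (c * d) (crossᵥ v w) ⟨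
          envelopeᵥ θ β γ (scaleᵥ (c * d) (crossᵥ v w))
              ≡⟨ cong (envelopeᵥ θ β γ) (cross-scale c v d w) ⟨
          envelopeᵥ θ β γ (crossᵥ (scaleᵥ c v) (scaleᵥ d w))
              ≡⟨ cong₂ (λ v w → envelopeᵥ θ β γ (crossᵥ v w)) Xl≡ Xm≡ ⟨
          envelopeᵥ θ β γ (crossᵥ (X l) (X m))                 ≡⟨ edge l≢m e ⟩
          0#                                                   ≡⟨ zeroʳ _ ⟨
          c * d * (c * d) * 0#                                 ∎)

    -- A line vanishing at three non-collinear points vanishes identically by Cramer's rule, whereas
    -- a tangent is nonzero at the other points of its own oval.
    tangent-off-third : ∀ {l m n k t} → l ≢ m → m ≢ n → l ≢ n → TangentAtᵀ k t →
      dotᵥ t (point l) ≡ 0# → dotᵥ t (point m) ≡ 0# → dotᵥ t (point n) ≢ 0#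
    tangent-off-third {l} {m} {n} {k} {t} l≢m m≢n l≢n Tt tl tm tn =
      let j , _ , k≢j , _ = two-others k in proj₂ Tt (≢-sym k≢j) (vanishes (pointᵀ j))
      where
      vanishes : ∀ v → dotᵥ t v ≡ 0#
      vanishes v = *-cancelˡ (non-collinear l≢m m≢n l≢n) (trans (cramer (point l) (point m) (point n) t v)
        (trans (cong₂ _+_ (cong₂ (λ e f → xₗ * e + xₘ * f) tl tm) (cong (xₙ *_) tn))
          (solve 4 (λ D x y z → x :* con o₀ :+ y :* con o₀ :+ z :* con o₀ := D :* con o₀) refl _ xₗ xₘ xₙ)))
        where
        xₗ xₘ xₙ : F
        xₗ = detᵥ (point m) (point n) v
        xₘ = detᵥ (point n) (point l) v
        xₙ = detᵥ (point l) (point m) v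

    module Frames {i₀ i₁ i₂ k₁ k₂ k₃ : Fin 10} {r₀ s₀ t₀ r s t : V}
      (S₀ : 𝕆.SymmetricTriple i₀ i₁ i₂ r₀ s₀ t₀) (S : 𝕋.SymmetricTriple k₁ k₂ k₃ r s t)
      (r-i₀ : dotᵥ r (point i₀) ≡ 0#) (r-i₁ : dotᵥ r (point i₁) ≡ 0#)
      (s-i₁ : dotᵥ s (point i₁) ≡ 0#) (s-i₂ : dotᵥ s (point i₂) ≡ 0#) (t-i₂ : dotᵥ t (point i₂) ≡ 0#)
      (r-i₂ : dotᵥ r (point i₂) ≢ 0#) (s-i₀ : dotᵥ s (point i₀) ≢ 0#)
      (t-i₀ : dotᵥ t (point i₀) ≢ 0#) (t-i₁ : dotᵥ t (point i₁) ≢ 0#) where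
      open 𝕆.SymmetricFrame S₀
      module F₁ = 𝕋.SymmetricFrame S

      -- The frame coordinates rescaled without division to normalise the conic.
      X : Fin 10 → V
      X l = b * c * x (point l) , c * a * y (point l) , a * b * z (point l)

      -- The line coordinates dual to X.
      L : V → V
      L q = a * dotᵥ q (point i₀) , b * dotᵥ q (point i₁) , c * dotᵥ q (point i₂)

      L-X : ∀ q l → dotᵥ (L q) (X l) ≡ a * b * c * (D * dotᵥ q (point l))
      L-X q l = trans (solve 9 (λ a b c x y z t₀ t₁ t₂ →
          :dot (a :* t₀ , b :* t₁ , c :* t₂) (b :* c :* x , c :* a :* y , a :* b :* z)
            := a :* b :* c :* (x :* t₀ :+ y :* t₁ :+ z :* t₂)) refl a b c (x v) (y v) (z v) _ _ _)
          (cong (a * b * c *_) (sym (frame-cramer q v)))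
        where
        v : V
        v = point l

      on-conic : ∀ l → conicᵥ (X l) ≡ 0#
      on-conic l = trans (solve 6 (λ a b c x y z →
          :conic (b :* c :* x , c :* a :* y , a :* b :* z)
            := a :* b :* c :* (a :* (y :* z) :+ b :* (z :* x) :+ c :* (x :* y))) refl a b c (x v) (y v) (z v))
          (trans (cong (a * b * c *_) (conic l)) (zeroʳ _))
        where
        v : V
        v = point l

      abcD≢0 : a * b * c * D ≢ 0#
      abcD≢0 = *-≢0 (*-≢0 (*-≢0 a≢0 b≢0) c≢0) D≢0

      -- The join of the points `m` and `n`, carried over to the new coordinates, vanishes at `X m`
      -- but not at `X l`. This is the witness for both `X≢0` and `X-∦`.
      separating : ∀ {l m n} → l ≢ m → m ≢ n → l ≢ n → dotᵥ (L (crossᵥ (point m) (point n))) (X l) ≢ 0#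
      separating {l} {m} {n} l≢m m≢n l≢n eq = *-≢0 abcD≢0 (non-collinear m≢n (≢-sym l≢n) (≢-sym l≢m))
        (trans (*-assoc _ _ _) (trans (sym (L-X (crossᵥ (point m) (point n)) l)) eq))

      X≢0 : ∀ l → X l ≢ 0ᵥ
      X≢0 l X≡0 = let m , n , l≢m , m≢n , l≢n = two-others l ; q = L (crossᵥ (point m) (point n)) in
        separating l≢m m≢n l≢n (trans (cong (dotᵥ q) X≡0)
          (solve 3 (λ q₁ q₂ q₃ → :dot (q₁ , q₂ , q₃) (con o₀ , con o₀ , con o₀) := con o₀) refl _ _ _))

      X-∦ : ∀ {l m} → l ≢ m → ¬ X l ∥ X m
      X-∦ {l} {m} l≢m (κ , _ , Xl≡) = let n , m≢n , l≢n = third l≢m ; q = crossᵥ (point m) (point n) in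
        separating l≢m m≢n l≢n (begin
          dotᵥ (L q) (X l)             ≡⟨ cong (dotᵥ (L q)) Xl≡ ⟩
          dotᵥ (L q) (scaleᵥ κ (X m))  ≡⟨ dot-scaleʳ κ (L q) (X m) ⟩
          κ * dotᵥ (L q) (X m)
              ≡⟨ cong (κ *_)
              (trans (L-X q m) (cong (λ e → a * b * c * (D * e)) (det-repeatˡ (point m) (point n)))) ⟩
          κ * (a * b * c * (D * 0#))
              ≡⟨ solve 3 (λ κ e D → κ :* (e :* (D :* con o₀)) := con o₀) refl κ (a * b * c) D ⟩
          0#                           ∎)

      L≢0 : ∀ {k q} → TangentAtᵀ k q → L q ≢ 0ᵥ
      L≢0 {q = q} Tq Lq≡0 = tangent-off-third {t = q} i₀≢i₁ i₁≢i₂ i₀≢i₂ Tq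
        (zero-factor a≢0 (cong proj₁ Lq≡0)) (zero-factor b≢0 (cong (proj₁ ∘ proj₂) Lq≡0))
        (zero-factor c≢0 (cong (proj₂ ∘ proj₂) Lq≡0))
        where
        open 𝕆.SymmetricTriple S₀ renaming (i≢j to i₀≢i₁; j≢k to i₁≢i₂; i≢k to i₀≢i₂)
        zero-factor : ∀ {x y} → x ≢ 0# → x * y ≡ 0# → y ≡ 0#
        zero-factor x≢0 eq = *-cancelˡ x≢0 (trans eq (sym (zeroʳ _)))

      -- In the coordinates `L` the tangents `r`, `s`, `t` become (0 , 0 , δ), (α , 0 , 0) and (η ,
      -- ζ , 0), the last proportional to (θ , 1 , 0). The values of β and γ come from substituting
      -- this into the conic of the other oval and dividing by the first coefficient.
      α η ζ δ θ β γ : F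
      α = a * dotᵥ s (point i₀)
      η = a * dotᵥ t (point i₀)
      ζ = b * dotᵥ t (point i₁)
      δ = c * dotᵥ r (point i₂)
      θ = η * inv ζ
      β = F₁.b * α * inv (F₁.a * δ)
      γ = F₁.c * ζ * inv (F₁.a * δ)

      α≢0 : α ≢ 0#
      α≢0 = *-≢0 a≢0 s-i₀
      ζ≢0 : ζ ≢ 0#
      ζ≢0 = *-≢0 b≢0 t-i₁
      Aδ≢0 : F₁.a * δ ≢ 0#
      Aδ≢0 = *-≢0 F₁.a≢0 (*-≢0 c≢0 r-i₂)
      θ≢0 : θ ≢ 0#
      θ≢0 = *-≢0 (*-≢0 a≢0 t-i₀) (inv-≢0 ζ≢0)
      β≢0 : β ≢ 0#
      β≢0 = *-≢0 (*-≢0 F₁.b≢0 α≢0) (inv-≢0 Aδ≢0)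
      γ≢0 : γ ≢ 0#
      γ≢0 = *-≢0 (*-≢0 F₁.c≢0 ζ≢0) (inv-≢0 Aδ≢0)

      -- By `tangent-polar`, `q` is up to `κ` the combination of `r`, `s`, `t` with the frame
      -- coordinates of its contact point as coefficients. So `κl₂`, `κl₁` and `shifted` recover
      -- these coordinates from `L q`, and the envelope equation is the conic equation of the
      -- contact point.
      tangent-on-envelope : ∀ {k q} → TangentAtᵀ k q → envelopeᵥ θ β γ (L q) ≡ 0#
      tangent-on-envelope {k} {q} Tq = *-cancelˡ (*-≢0 (*-≢0 κ≢0 κ≢0) Aδ≢0) (begin
        κ * κ * (F₁.a * δ) * envelopeᵥ θ β γ (L q)
          ≡⟨ solve 8 (λ κ e θ β γ l₀ l₁ l₂ → κ :* κ :* e :* :envelope θ β γ (l₀ , l₁ , l₂)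
               := e :* ((κ :* (l₀ :+ :- (θ :* l₁))) :* (κ :* l₁)) :+ (β :* e :* ((κ :* l₁) :* (κ :* l₂))
                  :+ γ :* e :* ((κ :* l₂) :* (κ :* (l₀ :+ :- (θ :* l₁)))))) refl κ (F₁.a * δ) θ β γ l₀ l₁ l₂ ⟩
        F₁.a * δ * ((κ * (l₀ + - (θ * l₁))) * (κ * l₁)) + (β * (F₁.a * δ) * ((κ * l₁) * (κ * l₂))
          + γ * (F₁.a * δ) * ((κ * l₂) * (κ * (l₀ + - (θ * l₁)))))
          ≡⟨ expand shifted κl₁ κl₂ (inv-cancelʳ Aδ≢0) (inv-cancelʳ Aδ≢0) ⟩
        F₁.a * δ * ((α * y₁) * (ζ * z₁)) + (F₁.b * α * ((ζ * z₁) * (δ * x₁))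
          + F₁.c * ζ * ((δ * x₁) * (α * y₁)))
          ≡⟨ solve 9 (λ A B C α ζ δ x y z → A :* δ :* ((α :* y) :* (ζ :* z)) :+ (B :* α :* ((ζ :* z) :*
              (δ :* x))
               :+ C :* ζ :* ((δ :* x) :* (α :* y)))
                   := α :* ζ :* δ :* (A :* (y :* z) :+ B :* (z :* x) :+ C :* (x :* y)))
               refl F₁.a F₁.b F₁.c α ζ δ x₁ y₁ z₁ ⟩
        α * ζ * δ * (F₁.a * (y₁ * z₁) + F₁.b * (z₁ * x₁) + F₁.c * (x₁ * y₁))
          ≡⟨ cong (α * ζ * δ *_) (F₁.conic k) ⟩
        α * ζ * δ * 0#
          ≡⟨ solve 2 (λ e f → e :* con o₀ := f :* con o₀) refl (α * ζ * δ) (κ * κ * (F₁.a * δ)) ⟩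
        κ * κ * (F₁.a * δ) * 0# ∎)
        where
        κ l₀ l₁ l₂ x₁ y₁ z₁ : F
        κ = proj₁ (F₁.tangent-polar Tq)
        l₀ = a * dotᵥ q (point i₀)
        l₁ = b * dotᵥ q (point i₁)
        l₂ = c * dotᵥ q (point i₂)
        x₁ = F₁.x (pointᵀ k)
        y₁ = F₁.y (pointᵀ k)
        z₁ = F₁.z (pointᵀ k)
        κ≢0 : κ ≢ 0#
        κ≢0 = proj₁ (proj₂ (F₁.tangent-polar Tq))
        expand : ∀ {e m m′ n n′ o o′ β β′ γ γ′ : F} → m ≡ m′ → n ≡ n′ → o ≡ o′ → β ≡ β′ → γ ≡ γ′ →
          e * (m * n) + (β * (n * o) + γ * (o * m)) ≡ e * (m′ * n′) + (β′ * (n′ * o′) + γ′ * (o′ * m′))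
        expand refl refl refl refl refl = refl
        at-point : ∀ v → κ * dotᵥ q v ≡ x₁ * dotᵥ r v + y₁ * dotᵥ s v + z₁ * dotᵥ t v
        at-point v = trans (proj₂ (proj₂ (F₁.tangent-polar Tq)) v) (F₁.dot-polar (pointᵀ k) v)
        weighted : ∀ e v → κ * (e * dotᵥ q v) ≡ e * (x₁ * dotᵥ r v + y₁ * dotᵥ s v + z₁ * dotᵥ t v)
        weighted e v = trans (solve 3 (λ κ e q → κ :* (e :* q)
            := e :* (κ :* q)) refl κ e (dotᵥ q v)) (cong (e *_) (at-point v))
        κl₀ : κ * l₀ ≡ α * y₁ + η * z₁
        κl₀ = trans (weighted a (point i₀)) (trans (cong (λ e → a * (x₁ * e + y₁ * _ + z₁ * _)) r-i₀)
          (solve 6 (λ a x y z s t → a :* (x :* con o₀ :+ y :* s :+ z :* t)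
              := a :* s :* y :+ a :* t :* z) refl a x₁ y₁ z₁ _ _))
        κl₁ : κ * l₁ ≡ ζ * z₁
        κl₁ = trans (weighted b (point i₁)) (trans (cong₂ (λ e f → b * (x₁ * e + y₁ * f + z₁ * _)) r-i₁ s-i₁)
          (solve 5 (λ b x y z t → b :* (x :* con o₀ :+ y :* con o₀ :+ z :* t)
              := b :* t :* z) refl b x₁ y₁ z₁ _))
        κl₂ : κ * l₂ ≡ δ * x₁
        κl₂ = trans (weighted c (point i₂)) (trans (cong₂ (λ e f → c * (x₁ * _ + y₁ * e + z₁ * f)) s-i₂ t-i₂)
          (solve 5 (λ c x y z r → c :* (x :* r :+ y :* con o₀ :+ z :* con o₀)
              := c :* r :* x) refl c x₁ y₁ z₁ _))
        shifted : κ * (l₀ + - (θ * l₁)) ≡ α * y₁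
        shifted = begin
          κ * (l₀ + - (θ * l₁))
              ≡⟨ solve 4 (λ κ l θ m → κ :* (l :+ :- (θ :* m))
              := κ :* l :+ :- (θ :* (κ :* m))) refl κ l₀ θ l₁ ⟩
          κ * l₀ + - (θ * (κ * l₁))            ≡⟨ cong₂ (λ e f → e + - (θ * f)) κl₀ κl₁ ⟩
          α * y₁ + η * z₁ + - (θ * (ζ * z₁))
              ≡⟨ solve 5 (λ u η z θ ζ → u :+ η :* z :+ :- (θ :* (ζ :* z))
              := u :+ (η :+ :- (θ :* ζ)) :* z) refl (α * y₁) η z₁ θ ζ ⟩
          α * y₁ + (η + - (θ * ζ)) * z₁        ≡⟨ cong (λ e → α * y₁ + (η + - e) * z₁) (inv-cancelʳ ζ≢0) ⟩
          α * y₁ + (η + - η) * z₁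
              ≡⟨ solve 3 (λ u η z → u :+ (η :+ :- η) :* z := u) refl (α * y₁) η z₁ ⟩
          α * y₁                               ∎

      edge : ∀ {l m} → l ≢ m → Edge l m → envelopeᵥ θ β γ (crossᵥ (X l) (X m)) ≡ 0#
      edge {l} {m} l≢m (q , k , Tq , ql , qm) = begin
        envelopeᵥ θ β γ (crossᵥ (X l) (X m))       ≡⟨ cong (envelopeᵥ θ β γ) cross≡ ⟩
        envelopeᵥ θ β γ (scaleᵥ κ (L q))           ≡⟨ envelope-scale θ β γ κ (L q) ⟩
        κ * κ * envelopeᵥ θ β γ (L q)              ≡⟨ cong (κ * κ *_) (tangent-on-envelope Tq) ⟩
        κ * κ * 0#                                 ≡⟨ zeroʳ _ ⟩
        0#                                         ∎
        where
        incident : ∀ n → dotᵥ q (point n) ≡ 0# → dotᵥ (L q) (X n) ≡ 0#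
        incident n qn = trans (L-X q n) (trans (cong (λ e → a * b * c * (D * e)) qn)
          (solve 2 (λ e D → e :* (D :* con o₀) := con o₀) refl (a * b * c) D))
        cross∥ : crossᵥ (X l) (X m) ∥ L q
        cross∥ = cross-zero⇒∥ (λ eq → X-∦ l≢m (cross-zero⇒∥ (X≢0 l) (X≢0 m) eq)) (L≢0 Tq)
          (double-cross (L q) (X l) (X m) (incident l ql) (incident m qm))
        κ : F
        κ = proj₁ cross∥
        cross≡ : crossᵥ (X l) (X m) ≡ scaleᵥ κ (L q)
        cross≡ = proj₂ (proj₂ cross∥)

      normal-form : NormalForm
      normal-form = record
        { X = X ; X≢0 = X≢0 ; X-∦ = X-∦ ; on-conic = on-conic
        ; θ = θ ; β = β ; γ = γ ; θ≢0 = θ≢0 ; β≢0 = β≢0 ; γ≢0 = γ≢0 ; edge = edge }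

    path⇒normal-form : ∀ {i₀ i₁ i₂ i₃} → i₀ ≢ i₁ → i₁ ≢ i₂ → i₀ ≢ i₂ → i₂ ≢ i₃ → i₀ ≢ i₃ → i₁ ≢ i₃ →
      Edge i₀ i₁ → Edge i₁ i₂ → Edge i₂ i₃ → NormalForm
    path⇒normal-form {i₀} {i₁} {i₂} {i₃} i₀≢i₁ i₁≢i₂ i₀≢i₂ i₂≢i₃ i₀≢i₃ i₁≢i₃
      (r , k₁ , Tr , r₀ , r₁) (s , k₂ , Ts , s₁ , s₂) (t , k₃ , Tt , t₂ , t₃) =
      let c , d , S = 𝕋.symmetrize k₁≢k₂ k₂≢k₃ k₁≢k₃ Tr Ts Tt
          open 𝕋.SymmetricTriple S renaming (Ts to Ts′; Tt to Tt′)
          _ , _ , S₀ =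
              𝕆.symmetrize i₀≢i₁ i₁≢i₂ i₀≢i₂ (proj₂ (𝕆.tangent-exists i₀)) (proj₂ (𝕆.tangent-exists i₁))
              (proj₂ (𝕆.tangent-exists i₂))
          s₁′ = scaled c s₁ ; s₂′ = scaled c s₂ ; t₂′ = scaled d t₂ ; t₃′ = scaled d t₃
      in Frames.normal-form S₀ S r₀ r₁ s₁′ s₂′ t₂′
        r₂
        (tangent-off-third i₁≢i₂ (≢-sym i₀≢i₂) (≢-sym i₀≢i₁) Ts′ s₁′ s₂′)
        (tangent-off-third i₂≢i₃ (≢-sym i₀≢i₃) (≢-sym i₀≢i₂) Tt′ t₂′ t₃′)
        (tangent-off-third i₂≢i₃ (≢-sym i₁≢i₃) (≢-sym i₁≢i₂) Tt′ t₂′ t₃′)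
      where
      r₂ : dotᵥ r (point i₂) ≢ 0#
      r₂ = tangent-off-third i₀≢i₁ i₁≢i₂ i₀≢i₂ Tr r₀ r₁
      s₃ : dotᵥ s (point i₃) ≢ 0#
      s₃ = tangent-off-third i₁≢i₂ i₂≢i₃ i₁≢i₃ Ts s₁ s₂
      -- Two edges of the path with the same contact point would be the same line by
      -- `tangent-unique`, and that line would contain three points of the other oval.
      k₁≢k₂ : k₁ ≢ k₂
      k₁≢k₂ refl = r₂ (𝕋.tangent-unique Ts Tr (point i₂) s₂)
      k₂≢k₃ : k₂ ≢ k₃
      k₂≢k₃ refl = s₃ (𝕋.tangent-unique Tt Ts (point i₃) t₃)
      k₁≢k₃ : k₁ ≢ k₃
      k₁≢k₃ refl = r₂ (𝕋.tangent-unique Tt Tr (point i₂) t₂)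
      scaled : ∀ {t v} k → dotᵥ t v ≡ 0# → dotᵥ (scaleᵥ k t) v ≡ 0#
      scaled {t} {v} k eq = trans (dot-scaleˡ k t v) (trans (cong (k *_) eq) (zeroʳ k))

-- Cycles and walks without turning back

record Cycle {A : Set} (E : A → A → Set) (m : ℕ) : Set where
  field
    at       : ℕ → A
    edge     : ∀ {i} → i < m → E (at i) (at (suc i))
    closed   : at m ≡ at 0
    simple   : ∀ {i j} → i < j → j < m → at i ≢ at j

module Walks (neighbours : Fin 10 → List (Fin 10)) where

  -- Lengths of the walks of at most f + k edges from s that never turn back,
  -- stop at the first return to s and start with k edges ending in p — c.
  returns : Fin 10 → (f k : ℕ) → Fin 10 → Fin 10 → List ℕ
  step    : Fin 10 → (f k : ℕ) → Fin 10 → Fin 10 → Fin 10 → List ℕ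
  returns s zero    k p c = []
  returns s (suc f) k p c = concatMap (step s f k p c) (neighbours c)
  step s f k p c n with n Fin.≟ p | n Fin.≟ s
  ... | yes _ | _     = []
  ... | no _  | yes _ = [ suc k ]
  ... | no _  | no _  = returns s f (suc k) c n

  lengthsFrom : Fin 10 → List ℕ
  -- One edge is already taken, so fuel 9 admits closed walks of up to 10 edges.
  lengthsFrom s = concatMap (returns s 9 1 s) (neighbours s)

  cycleLengths : List ℕ
  cycleLengths = concatMap lengthsFrom (allFin 10)

  module _ {m : ℕ} (C : Cycle (λ c d → d ∈ neighbours c) m) (3≤m : 3 ≤ m) where
    open Cycle C

    -- Following the cycle itself is one of the enumerated walks: simplicity excludes turning back
    -- and an early return, and closedness makes the walk stop after exactly `m` edges.
    returns-complete : ∀ f k → suc k < m → m ≤ f ℕ.+ suc k → m ∈ returns (at 0) f (suc k) (at k) (at (suc k))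
    returns-complete zero    k k<m m≤k = ⊥-elim (ℕ.<⇒≱ k<m m≤k)
    returns-complete (suc f) k k<m m≤  =
        ∈-concatMap⁺ (step (at 0) f (suc k) (at k) (at (suc k))) (lose (edge k<m) next)
      where
      next : m ∈ step (at 0) f (suc k) (at k) (at (suc k)) (at (suc (suc k)))
      next with at (suc (suc k)) Fin.≟ at k | at (suc (suc k)) Fin.≟ at 0 | ℕ.m≤n⇒m<n∨m≡n k<m
      ... | yes back | _ | inj₁ k<m′ = ⊥-elim (simple (ℕ.m≤n⇒m≤1+n ℕ.≤-refl) k<m′ (sym back))
      -- On the last edge, turning back would identify the start with the vertex at position m - 2,
      -- which differs from it because `m` is at least 3.
      ... | yes back | _ | inj₂ refl = ⊥-elim (simple (ℕ.≤-pred (ℕ.≤-pred 3≤m)) (ℕ.m≤n⇒m≤1+n ℕ.≤-refl)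
          (trans (sym closed) back))
      ... | no _ | yes ret | inj₁ k<m′ = ⊥-elim (simple (s≤s z≤n) k<m′ (sym ret))
      ... | no _ | yes ret | inj₂ refl = here refl
      ... | no _ | no  _   | inj₁ k<m′ =
          returns-complete f (suc k) k<m′ (subst (m ≤_) (sym (ℕ.+-suc f (suc k))) m≤)
      ... | no _ | no  ¬ret | inj₂ refl = ⊥-elim (¬ret closed)

    cycleLengths-complete : m ≤ 10 → m ∈ cycleLengths
    cycleLengths-complete m≤10 = ∈-concatMap⁺ lengthsFrom (lose (∈-allFin (at 0))
      (∈-concatMap⁺ (returns (at 0) 9 1 (at 0)) (lose (edge (ℕ.<-≤-trans (s≤s z≤n) 3≤m))
        (returns-complete 9 0 (ℕ.<-≤-trans (s≤s (s≤s z≤n)) 3≤m) m≤10))))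

-- The concrete field and exhaustive checks over it

all₃? : {P : F3 → Set} → (∀ x → Dec (P x)) → Dec (∀ x → P x)
all₃? P? = map′ (λ (p , q , r) → λ { o₀ → p ; o₁ → q ; o₂ → r }) (λ f → f o₀ , f o₁ , f o₂)
  (P? o₀ ×-dec P? o₁ ×-dec P? o₂)

any₃? : {P : F3 → Set} → (∀ x → Dec (P x)) → Dec (∃ P)
any₃? P? = map′ (λ { (inj₁ p) → o₀ , p ; (inj₂ (inj₁ p)) → o₁ , p ; (inj₂ (inj₂ p)) → o₂ , p })
  (λ { (o₀ , p) → inj₁ p ; (o₁ , p) → inj₂ (inj₁ p) ; (o₂ , p) → inj₂ (inj₂ p) })
  (P? o₀ ⊎-dec P? o₁ ⊎-dec P? o₂)

all₉? : {P : GF9 → Set} → (∀ x → Dec (P x)) → Dec (∀ x → P x)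
all₉? P? = map′ (λ f (x , y) → f x y) (λ f x y → f (x , y)) (all₃? λ x → all₃? λ y → P? (x , y))

any₉? : {P : GF9 → Set} → (∀ x → Dec (P x)) → Dec (∃ P)
any₉? P? =
    map′ (λ (x , y , p) → (x , y) , p) (λ ((x , y) , p) → x , y , p) (any₃? λ x → any₃? λ y → P? (x , y))

allᵥ? : {P : Vec3 → Set} → (∀ v → Dec (P v)) → Dec (∀ v → P v)
allᵥ? P? = map′ (λ f (x , y , z) → f x y z) (λ f x y z → f (x , y , z))
  (all₉? λ x → all₉? λ y → all₉? λ z → P? (x , y , z))

anyᵥ? : {P : Vec3 → Set} → (∀ v → Dec (P v)) → Dec (∃ P)
anyᵥ? P? = map′ (λ (x , y , z , p) → (x , y , z) , p) (λ ((x , y , z) , p) → x , y , z , p)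
  (any₉? λ x → any₉? λ y → any₉? λ z → P? (x , y , z))

1F : GF9
1F = o₁ , o₀

-F_ : GF9 → GF9
-F (a , b) = (-₃ a) , (-₃ b)

-- x⁻¹ = x⁷
invF : GF9 → GF9
invF x = x *F (x² *F (x² *F x²))
  where x² = x *F x

nonzerosF : List GF9
nonzerosF = (o₀ , o₁) ∷ (o₀ , o₂) ∷ (o₁ , o₀) ∷ (o₁ , o₁) ∷ (o₁ , o₂) ∷ (o₂ , o₀) ∷ (o₂ , o₁) ∷ (o₂ , o₂) ∷ []

abstract
  +F-assoc : ∀ x y z → (x +F y) +F z ≡ x +F (y +F z)
  +F-assoc = from-yes (all₉? λ x → all₉? λ y → all₉? λ z → ((x +F y) +F z) ≟F (x +F (y +F z)))

  +F-comm : ∀ x y → x +F y ≡ y +F x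
  +F-comm = from-yes (all₉? λ x → all₉? λ y → (x +F y) ≟F (y +F x))

  +F-inverse : ∀ x → (-F x) +F x ≡ 0F
  +F-inverse = from-yes (all₉? λ x → ((-F x) +F x) ≟F 0F)

  *F-assoc : ∀ x y z → (x *F y) *F z ≡ x *F (y *F z)
  *F-assoc = from-yes (all₉? λ x → all₉? λ y → all₉? λ z → ((x *F y) *F z) ≟F (x *F (y *F z)))

  *F-comm : ∀ x y → x *F y ≡ y *F x
  *F-comm = from-yes (all₉? λ x → all₉? λ y → (x *F y) ≟F (y *F x))

  *F-identity : ∀ x → 1F *F x ≡ x
  *F-identity = from-yes (all₉? λ x → (1F *F x) ≟F x)

  *F-distrib : ∀ x y z → x *F (y +F z) ≡ (x *F y) +F (x *F z)
  *F-distrib = from-yes (all₉? λ x → all₉? λ y → all₉? λ z → (x *F (y +F z)) ≟F ((x *F y) +F (x *F z)))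

  invF-inverse : ∀ x → x ≢ 0F → x *F invF x ≡ 1F
  invF-inverse = from-yes (all₉? λ x → ¬? (x ≟F 0F) →-dec ((x *F invF x) ≟F 1F))

isCommutativeRingF : IsCommutativeRing _≡_ _+F_ _*F_ -F_ 0F 1F
isCommutativeRingF = record
  { isRing = record
    { +-isAbelianGroup = record
      { isGroup = record
        { isMonoid = record
          { isSemigroup = record
            { isMagma = record { isEquivalence = isEquivalence ; ∙-cong = cong₂ _+F_ }
            ; assoc = +F-assoc }
          ; identity = Consequences.comm∧idˡ⇒id +F-comm (λ _ → refl) }
        ; inverse = Consequences.comm∧invˡ⇒inv +F-comm +F-inverse
        ; ⁻¹-cong = cong -F_ }
      ; comm = +F-comm }
    ; *-cong = cong₂ _*F_
    ; *-assoc = *F-assoc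
    ; *-identity = Consequences.comm∧idˡ⇒id *F-comm *F-identity
    ; distrib = *F-distrib , Consequences.comm∧distrˡ⇒distrʳ *F-comm *F-distrib }
  ; *-comm = *F-comm }

abstract
  nonzerosF-unique : Unique nonzerosF
  nonzerosF-unique = from-yes (unique? _≟F_ nonzerosF)

  nonzerosF-nonzero : ∀ {x} → x ∈ nonzerosF → x ≢ 0F
  nonzerosF-nonzero = All.lookup (from-yes (All.all? (λ x → ¬? (x ≟F 0F)) nonzerosF))

  nonzerosF-complete : ∀ x → x ≢ 0F → x ∈ nonzerosF
  nonzerosF-complete = from-yes (all₉? λ x → ¬? (x ≟F 0F) →-dec (x ∈? nonzerosF))
    where open DecMembership _≟F_ using (_∈?_)

gf9 : Field9
gf9 = record
  { isCommutativeRing = isCommutativeRingF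
  ; inv = invF
  ; inv-inverse = invF-inverse
  ; 1≢0 = λ ()
  ; char3 = refl
  ; _≟_ = _≟F_
  ; nonzeros = nonzerosF
  ; nonzeros-unique = nonzerosF-unique
  ; nonzeros-nonzero = nonzerosF-nonzero
  ; nonzeros-complete = nonzerosF-complete
  ; nonzeros-length = refl
  ; nonzeros-product = refl
  }

open VectorOps _+F_ _*F_ -F_
open Plane gf9 using (_∥_; ∥-join; dot-∥; pairwise⇒non-collinear; Arc)
open NormalForms gf9 using (Edge; NormalForm; module NormalForm; path⇒normal-form)

_≟ᵥ_ : (v w : Vec3) → Dec (v ≡ w)
_≟ᵥ_ = ≡-dec _≟F_ (≡-dec _≟F_ _≟F_)

∥? : ∀ v w → Dec (v ∥ w)
∥? v w = any₉? λ c → ¬? (c ≟F 0F) ×-dec (v ≟ᵥ scaleᵥ c w)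

-- For x = 1 the equation reads (y + 1)(z + 1) = 1, which has eight solutions; the other two points
-- have x = 0.
conic-vertices : Vec Vec3 10
conic-vertices =
  (0F , 1F , 0F) ∷ (0F , 0F , 1F) ∷ (1F , 0F , 0F) ∷ (1F , (o₀ , o₁) , (o₁ , o₁)) ∷ (1F , (o₀ , o₂) ,
      (o₁ , o₂))
    ∷ (1F , 1F , 1F) ∷ (1F , (o₁ , o₁) , (o₀ , o₁)) ∷ (1F , (o₁ , o₂) , (o₀ , o₂))
    ∷ (1F , (o₂ , o₁) , (o₂ , o₂)) ∷ (1F , (o₂ , o₂) , (o₂ , o₁)) ∷ []

abstract
  conic-point : ∀ v → NonZeroV v → conicᵥ v ≡ 0F → ∃ λ i → v ∥ lookup conic-vertices i
  conic-point =
      from-yes (allᵥ? λ v → ¬? (v ≟ᵥ zero3) →-dec ((conicᵥ v ≟F 0F) →-dec Fin.any? λ i → ∥? v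
      (lookup conic-vertices i)))

-- The 512 normalised graphs

joins : Vec (Vec Vec3 10) 10
joins = Vec.map (λ v → Vec.map (crossᵥ v) conic-vertices) conic-vertices

module _ (J : Vec (Vec Vec3 10) 10) (θ β γ : GF9) where

  adjacent? : ∀ c d → Dec (c ≢ d × envelopeᵥ θ β γ (lookup (lookup J c) d) ≡ 0F)
  adjacent? c d = ¬? (c Fin.≟ d) ×-dec (envelopeᵥ θ β γ (lookup (lookup J c) d) ≟F 0F)

  adjacent : Fin 10 → List (Fin 10)
  adjacent c = filter (adjacent? c) (allFin 10)

  -- Tabulated because evaluation shares the entries of a table.
  adjacency : Vec (List (Fin 10)) 10
  adjacency = tabulate adjacent

AllEqual : List ℕ → Set
AllEqual []       = ⊤
AllEqual (x ∷ xs) = All (x ≡_) xs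

allEqual? : ∀ xs → Dec (AllEqual xs)
allEqual? []       = yes tt
allEqual? (x ∷ xs) = All.all? (x ℕ.≟_) xs

AllEqual⇒≡ : ∀ {xs x y} → AllEqual xs → x ∈ xs → y ∈ xs → x ≡ y
AllEqual⇒≡ {_ ∷ _} eq (here refl) (here refl) = refl
AllEqual⇒≡ {_ ∷ _} eq (here refl) (there y∈)  = All.lookup eq y∈
AllEqual⇒≡ {_ ∷ _} eq (there x∈)  (here refl) = sym (All.lookup eq x∈)
AllEqual⇒≡ {_ ∷ _} eq (there x∈)  (there y∈)  = trans (sym (All.lookup eq x∈)) (All.lookup eq y∈)

lengths : (J : Vec (Vec Vec3 10) 10) (θ β γ : GF9) → List ℕ
lengths J θ β γ = Walks.cycleLengths (lookup (adjacency J θ β γ))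

abstract
  -- Nonzero β and γ make the dual conic nondegenerate, so at most two of its lines pass through a
  -- point and every vertex has degree at most 2: a walk is determined by its first edge. That all
  -- closed walks of one graph have the same length is checked case by case.
  lengths-equal : ∀ θ β γ → θ ≢ 0F → β ≢ 0F → γ ≢ 0F → AllEqual (lengths joins θ β γ)
  lengths-equal = from-yes (check joins)
    where
    -- The table is a bound variable here, so that all cases share one evaluation of `joins`.
    check : ∀ J → Dec (∀ θ β γ → θ ≢ 0F → β ≢ 0F → γ ≢ 0F → AllEqual (lengths J θ β γ))
    check J = all₉? λ θ → all₉? λ β → all₉? λ γ →
      ¬? (θ ≟F 0F) →-dec (¬? (β ≟F 0F) →-dec (¬? (γ ≟F 0F) →-dec allEqual? (lengths J θ β γ)))

-- From Poncelet polygons to cycles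

arc : Oval → Arc
arc O = record
  { point = pt O
  ; non-collinear = λ {i} {j} {k} i≢j j≢k i≢k → pairwise⇒non-collinear (nonzero O i) (nonzero O j)
      (distinct O i j i≢j) (λ ℓ → noThreeCollinear O i j k i≢j j≢k i≢k ℓ) }

length-1 : ∀ {A : Set} {xs : List A} → length xs ≡ 1 → ∃ λ x → x ∈ xs × (∀ {y} → y ∈ xs → y ≡ x)
length-1 {xs = x ∷ []} refl = x , here refl , λ { (here eq) → eq }

tangent⇒TangentAt : ∀ O {ℓ} → Tangent O ℓ → ∃ λ k → Arc.TangentAt (arc O) k ℓ
tangent⇒TangentAt O {ℓ} (_ , once) with length-1 once
... | k , k∈ , only = k , proj₂ (∈-filter⁻ on? {xs = allFin 10} k∈) ,
  λ j≢k on → j≢k (only (∈-filter⁺ on? (∈-allFin _) on))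
  where
  on? : ∀ i → Dec (dot ℓ (pt O i) ≡ 0F)
  on? i = dot ℓ (pt O i) ≟F 0F

TangentJoin : Oval → Oval → Fin 10 → Fin 10 → Set
TangentJoin Ot Os l m = Σ Vec3 λ ℓ → Tangent Ot ℓ × OnLine ℓ (pt Os l) × OnLine ℓ (pt Os m)

join⇒edge : ∀ Ot Os {l m} → TangentJoin Ot Os l m → Edge (arc Ot) (arc Os) l m
join⇒edge Ot Os (ℓ , T , onₗ , onₘ) = let k , Tk = tangent⇒TangentAt Ot T in ℓ , k , Tk , onₗ , onₘ

-- Vertices are named by their indices on the oval instead of by vectors up to scalars, which makes
-- coincidence of vertices an equality and the search for polygons finite.
IndexPolygon : Oval → Oval → (m : ℕ) → (Fin m → Fin 10) → Set
IndexPolygon Ot Os m σ =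
  (∀ i j → i ≢ j → σ i ≢ σ j) × (∀ i j → CycSucc m i j → TangentJoin Ot Os (σ i) (σ j))

polygon⇒index : ∀ Ot Os {m} → PonceletPolygon Ot Os m → ∃ (IndexPolygon Ot Os m)
polygon⇒index Ot Os (P , onOval , P-distinct , sides) =
  (λ i → proj₁ (onOval i)) ,
  (λ i j i≢j σ≡ → P-distinct i j i≢j
    (∥-join (proj₂ (onOval i)) (subst (λ k → P j ∥ pt Os k) (sym σ≡) (proj₂ (onOval j))))) ,
  (λ i j next → let ℓ , T , onᵢ , onⱼ = sides i j next in
    ℓ , T , dot-∥ ℓ {P i} (proj₂ (onOval i)) onᵢ , dot-∥ ℓ {P j} (proj₂ (onOval j)) onⱼ)

index⇒polygon : ∀ Ot Os {m} → ∃ (IndexPolygon Ot Os m) → PonceletPolygon Ot Os m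
index⇒polygon Ot Os (σ , σ-distinct , sides) =
  (λ i → pt Os (σ i)) ,
  (λ i → σ i , 1F , (λ ()) , sym (identity (pt Os (σ i)))) ,
  (λ i j i≢j → distinct Os (σ i) (σ j) (σ-distinct i j i≢j)) ,
  sides
  where
  identity : ∀ v → scale 1F v ≡ v
  identity (x , y , z) = cong₂ _,_ (*F-identity x) (cong₂ _,_ (*F-identity y) (*F-identity z))

-- Indices are read modulo `m`: the wrap-around clause of `CycSucc` becomes the last edge, and
-- closedness holds because `m` reduces to 0.
index⇒cycle : ∀ Ot Os {m} → 3 ≤ m → ∃ (IndexPolygon Ot Os m) → Cycle (TangentJoin Ot Os) m
index⇒cycle Ot Os {m@(suc _)} 3≤m (σ , σ-distinct , sides) = record
  { at     = λ i → σ (i mod m)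
  ; edge   = λ {i} i<m → sides (i mod m) (suc i mod m) (successor i<m)
  ; closed = cong σ (Fin.toℕ-injective (trans (toℕ-mod m) (trans (n%n≡0 m) (sym (toℕ-mod 0)))))
  ; simple = λ {i} {j} i<j j<m → σ-distinct (i mod m) (j mod m)
      (λ eq → ℕ.<⇒≢ i<j (trans (sym (small (ℕ.<-trans i<j j<m))) (trans (cong Fin.toℕ eq) (small j<m)))) }
  where
  toℕ-mod : ∀ i → Fin.toℕ (i mod m) ≡ i % m
  toℕ-mod i = Fin.toℕ-fromℕ< _
  small : ∀ {i} → i < m → Fin.toℕ (i mod m) ≡ i
  small {i} i<m = trans (toℕ-mod i) (m<n⇒m%n≡m i<m)
  successor : ∀ {i} → i < m → CycSucc m (i mod m) (suc i mod m)
  successor {i} i<m with ℕ.m≤n⇒m<n∨m≡n i<m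
  ... | inj₁ i+1<m = inj₁ (trans (cong suc (small i<m)) (sym (small i+1<m)))
  ... | inj₂ refl  = inj₂ (cong suc (small i<m) , trans (toℕ-mod m) (n%n≡0 m))

consecutive-distinct : ∀ {A : Set} {E : A → A → Set} {m i} (C : Cycle E m) → 2 ≤ m → i < m →
  Cycle.at C i ≢ Cycle.at C (suc i)
consecutive-distinct {m = m} C 2≤m i<m eq with ℕ.m≤n⇒m<n∨m≡n i<m
... | inj₁ i+1<m = Cycle.simple C ℕ.≤-refl i+1<m eq
... | inj₂ refl  = Cycle.simple C (ℕ.≤-pred 2≤m) ℕ.≤-refl (sym (trans eq (Cycle.closed C)))

cycle-map : ∀ {A B : Set} {E : A → A → Set} {E′ : B → B → Set} {m} (f : A → B) →
    (∀ {a b} → f a ≡ f b → a ≡ b) →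
  (∀ {a b} → a ≢ b → E a b → E′ (f a) (f b)) → 2 ≤ m → Cycle E m → Cycle E′ m
cycle-map f injective hom 2≤m C = record
  { at     = λ i → f (at i)
  ; edge   = λ i<m → hom (consecutive-distinct C 2≤m i<m) (edge i<m)
  ; closed = cong f closed
  ; simple = λ i<j j<m eq → simple i<j j<m (injective eq) }
  where open Cycle C

join : ∀ c d → lookup (lookup joins c) d ≡ crossᵥ (lookup conic-vertices c) (lookup conic-vertices d)
join c d =
    trans (cong (λ row → lookup row d) (Vec.lookup-map c (λ v → Vec.map
    (crossᵥ v) conic-vertices) conic-vertices))
  (Vec.lookup-map d (crossᵥ (lookup conic-vertices c)) conic-vertices)

-- Comparison of two cycles

module NormalFormGraph {T O : Arc} (N : NormalForm T O) where
  open NormalForm N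

  neighbours : Fin 10 → List (Fin 10)
  neighbours = lookup (adjacency joins θ β γ)

  code : Fin 10 → Fin 10
  code l = proj₁ (conic-point (X l) (X≢0 l) (on-conic l))

  X∥code : ∀ l → X l ∥ lookup conic-vertices (code l)
  X∥code l = proj₂ (conic-point (X l) (X≢0 l) (on-conic l))

  code-injective : ∀ {l m} → code l ≡ code m → l ≡ m
  code-injective {l} {m} eq with l Fin.≟ m
  ... | yes l≡m = l≡m
  ... | no  l≢m =
      ⊥-elim (X-∦ l≢m (∥-join (X∥code l) (subst (λ c → X m ∥ lookup conic-vertices c) (sym eq) (X∥code m))))

  edge⇒neighbour : ∀ {l m} → l ≢ m → Edge T O l m → code m ∈ neighbours (code l)
  edge⇒neighbour {l} {m} l≢m e = subst (code m ∈_) (sym (Vec.lookup∘tabulate (adjacent joins θ β γ) (code l)))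
    (∈-filter⁺ (adjacent? joins θ β γ (code l)) (∈-allFin (code m))
      ( (λ eq → l≢m (code-injective eq))
      , trans (cong (envelopeᵥ θ β γ) (join (code l) (code m))) (edge-∥ l≢m e (X∥code l) (X∥code m))))

  cycle-length : ∀ {m} → 3 ≤ m → m ≤ 10 → Cycle (Edge T O) m → m ∈ lengths joins θ β γ
  cycle-length 3≤m m≤10 C = Walks.cycleLengths-complete neighbours
    (cycle-map code code-injective edge⇒neighbour (ℕ.<⇒≤ 3≤m) C) 3≤m m≤10

  same-length : ∀ {m n} → 3 ≤ m → m ≤ 10 → 3 ≤ n → n ≤ 10 → Cycle (Edge T O) m → Cycle (Edge T O) n → m ≡ n
  same-length 3≤m m≤10 3≤n n≤10 C C′ = AllEqual⇒≡ (lengths-equal θ β γ θ≢0 β≢0 γ≢0)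
    (cycle-length 3≤m m≤10 C) (cycle-length 3≤n n≤10 C′)

long-cycle⇒normal-form : ∀ T O {m} → 4 ≤ m → Cycle (Edge T O) m → NormalForm T O
long-cycle⇒normal-form T O {m} 4≤m C = path⇒normal-form T O
  (simple (s≤s z≤n) 1<m) (simple (s≤s (s≤s z≤n)) 2<m) (simple (s≤s z≤n) 2<m)
  (simple (s≤s (s≤s (s≤s z≤n))) 4≤m) (simple (s≤s z≤n) 4≤m) (simple (s≤s (s≤s z≤n)) 4≤m)
  (edge (ℕ.<-trans (s≤s z≤n) 1<m)) (edge 1<m) (edge 2<m)
  where
  open Cycle C
  2<m : 2 < m
  2<m = ℕ.<⇒≤ 4≤m
  1<m : 1 < m
  1<m = ℕ.<⇒≤ 2<m

-- The normal form belongs to the pair of ovals, so one built from either cycle measures both, even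
-- if the other is a triangle. Only when both are triangles is there no path of four distinct
-- vertices at hand, and then the lengths agree anyway.
cycles-same-length : ∀ T O {m n} → 3 ≤ m → m ≤ 10 → 3 ≤ n → n ≤ 10 →
  Cycle (Edge T O) m → Cycle (Edge T O) n → m ≡ n
cycles-same-length T O 3≤m m≤10 3≤n n≤10 C C′ with ℕ.m≤n⇒m<n∨m≡n 3≤m | ℕ.m≤n⇒m<n∨m≡n 3≤n
... | inj₁ 4≤m  | _         =
    NormalFormGraph.same-length (long-cycle⇒normal-form T O 4≤m C) 3≤m m≤10 3≤n n≤10 C C′
... | inj₂ _    | inj₁ 4≤n  =
    NormalFormGraph.same-length (long-cycle⇒normal-form T O 4≤n C′) 3≤m m≤10 3≤n n≤10 C C′
... | inj₂ refl | inj₂ refl = refl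

polygons-same-length : ∀ Ot Os {m n} → 3 ≤ m → m ≤ 10 → 3 ≤ n → n ≤ 10 →
  PonceletPolygon Ot Os m → PonceletPolygon Ot Os n → m ≡ n
polygons-same-length Ot Os 3≤m m≤10 3≤n n≤10 P Q =
  cycles-same-length (arc Ot) (arc Os) 3≤m m≤10 3≤n n≤10 (cycle 3≤m P) (cycle 3≤n Q)
  where
  cycle : ∀ {m} → 3 ≤ m → PonceletPolygon Ot Os m → Cycle (Edge (arc Ot) (arc Os)) m
  cycle 3≤m P =
      cycle-map (λ l → l) (λ eq → eq) (λ _ → join⇒edge Ot Os) (ℕ.<⇒≤ 3≤m) (index⇒cycle Ot Os 3≤m
      (polygon⇒index Ot Os P))

-- Decidability and the trichotomy

anyVec? : ∀ {n} m {Q : Vec (Fin n) m → Set} → (∀ w → Dec (Q w)) → Dec (∃ Q)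
anyVec? zero    Q? = map′ (λ q → [] , q) (λ { ([] , q) → q }) (Q? [])
anyVec? (suc m) Q? = map′ (λ (x , w , q) → x ∷ w , q) (λ { (x ∷ w , q) → x , w , q })
  (Fin.any? λ x → anyVec? m λ w → Q? (x ∷ w))

nonZero? : ∀ v → Dec (NonZeroV v)
nonZero? v = ¬? (v ≟ᵥ zero3)

tangent? : ∀ O ℓ → Dec (Tangent O ℓ)
tangent? O ℓ = nonZero? ℓ ×-dec (meetCount O ℓ ℕ.≟ 1)

secant? : ∀ O ℓ → Dec (Secant O ℓ)
secant? O ℓ = nonZero? ℓ ×-dec (meetCount O ℓ ℕ.≟ 2)

abstract
  indexPolygon? : ∀ Ot Os m σ → Dec (IndexPolygon Ot Os m σ)
  indexPolygon? Ot Os m σ =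
    (Fin.all? λ i → Fin.all? λ j → ¬? (i Fin.≟ j) →-dec ¬? (σ i Fin.≟ σ j)) ×-dec
    (Fin.all? λ i → Fin.all? λ j →
      ((suc (Fin.toℕ i) ℕ.≟ Fin.toℕ j) ⊎-dec ((suc (Fin.toℕ i) ℕ.≟ m) ×-dec (Fin.toℕ j ℕ.≟ 0))) →-dec
      anyᵥ? λ ℓ → tangent? Ot ℓ ×-dec ((dot ℓ (pt Os (σ i)) ≟F 0F) ×-dec (dot ℓ (pt Os (σ j)) ≟F 0F)))

  -- The trichotomy needs a constructive decision whether a polygon exists. The search runs over
  -- vectors of indices, and `vector` passes from a function to its table pointwise, without
  -- function extensionality.
  polygon? : ∀ Ot Os m → Dec (PonceletPolygon Ot Os m)
  polygon? Ot Os m =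
      map′ (λ (w , p) → index⇒polygon Ot Os (lookup w , p)) (λ P → vector (polygon⇒index Ot Os P))
    (anyVec? m λ w → indexPolygon? Ot Os m (lookup w))
    where
    vector : ∃ (IndexPolygon Ot Os m) → ∃ λ w → IndexPolygon Ot Os m (lookup w)
    vector (σ , σ-distinct , sides) = tabulate σ ,
      (λ i j i≢j eq → σ-distinct i j i≢j
          (trans (sym (Vec.lookup∘tabulate σ i)) (trans eq (Vec.lookup∘tabulate σ j)))) ,
      (λ i j next → subst₂ (TangentJoin Ot Os) (sym (Vec.lookup∘tabulate σ i)) (sym (Vec.lookup∘tabulate σ j))
          (sides i j next))

  somePolygon? : ∀ Ot Os → Dec (∃ λ (k : Fin 8) → PonceletPolygon Ot Os (3 ℕ.+ Fin.toℕ k))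
  somePolygon? Ot Os = Fin.any? λ k → polygon? Ot Os (3 ℕ.+ Fin.toℕ k)

  secantTangent? : ∀ Ot Os → Dec (Σ Vec3 λ ℓ → Secant Os ℓ × Tangent Ot ℓ)
  secantTangent? Ot Os = anyᵥ? λ ℓ → secant? Os ℓ ×-dec tangent? Ot ℓ

theorem1 : ∀ (Ot Os : Oval) →
    (Σ ℕ (λ m → PonceletMPair Ot Os m)) ⊎ Poncelet0Pair Ot Os ⊎ PonceletInfPair Ot Os
theorem1 Ot Os with somePolygon? Ot Os
... | yes (k , P) = inj₁ (3 ℕ.+ Fin.toℕ k , 3≤m , m≤10 , P ,
    λ n 3≤n n≤10 n≢m Q → n≢m (polygons-same-length Ot Os 3≤n n≤10 3≤m m≤10 Q P))
  where
  3≤m : 3 ≤ 3 ℕ.+ Fin.toℕ k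
  3≤m = ℕ.m≤m+n 3 (Fin.toℕ k)
  m≤10 : 3 ℕ.+ Fin.toℕ k ≤ 10
  m≤10 = ℕ.+-monoʳ-≤ 3 (ℕ.≤-pred (Fin.toℕ<n k))
... | no none with secantTangent? Ot Os
...   | yes ℓ = inj₂ (inj₂ (ℓ , λ m 3≤m m≤10 P → none
          -- The eight admissible lengths 3 to 10 are numbered from 0, so length `m` has index m -
          -- 3.
          ( Fin.fromℕ< (s≤s (ℕ.∸-monoˡ-≤ 3 m≤10))
          , subst (PonceletPolygon Ot Os) (sym
              (trans (cong (3 ℕ.+_) (Fin.toℕ-fromℕ< _)) (ℕ.m+[n∸m]≡n 3≤m))) P)))
...   | no ¬ℓ = inj₂ (inj₁ λ ℓ S T → ¬ℓ (ℓ , S , T))
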